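{- For all $n\ge0$, $$H_n\big((2k+1)B_{2k}\big)=\frac{(-1)^n(2n+2)!}{n!(n+1)!^3}\cdot\left(\mathcal{H}_n+\mathcal{H}_{n+1}\right)\cdot H_n\big((2k+3)B_{2k+2}\big),$$ where $B_j$ are the Bernoulli numbers and $\mathcal{H}_m:=\sum_{j=1}^m\frac1j$ (with $\mathcal{H}_0=0$).
   Context: For a sequence $(a_k)_{k\ge 0}$ and $n\ge 0$, $H_n(a_k):=\det(a_{i+j})_{0\le i,j\le n}$ denotes the $(n+1)\times(n+1)$ Hankel determinant; in the claim the sequences are indexed by $k\ge0$. The Bernoulli numbers are defined by $\frac{t}{e^t-1}=\sum_{n\ge0}B_n\frac{t^n}{n!}$. The notation $(n+1)!^3$ means $((n+1)!)^3$. -}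

module Defs where

open import Algebra.Bundles using (module CommutativeRing)
open import Data.Fin.Base using (Fin; zero; suc; toℕ; punchIn)
open import Data.Integer.Base as ℤ using (+_; 1ℤ)
open import Data.Nat.Base as ℕ using (ℕ; zero; suc; _∸_; _!)
import Data.Nat.Properties as ℕ
open import Data.Rational.Base
open import Data.Rational.Properties
import Data.Rational.Unnormalised.Base as ℚᵘ
import Data.Rational.Unnormalised.Properties as ℚᵘ
open import Data.Vec.Base using (Vec; []; _∷_; head; lookup)
open import Relation.Binary.PropositionalEquality

open import Algebra.Definitions.RawSemiring +-*-rawSemiring public
  using (_^_)
open import Algebra.Properties.Semiring.Sum (CommutativeRing.semiring +-*-commutativeRing) public
  using (sum; sum-cong-≗)

-- Formal power series over ℚ, given by their coefficients

Series : Set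
Series = ℕ → ℚ

𝟙 : Series
𝟙 zero    = 1ℚ
𝟙 (suc _) = 0ℚ

𝕥 : Series
𝕥 zero    = 0ℚ
𝕥 (suc n) = 𝟙 n

-- f(t) ↦ (f(t) − f(0)) / t

shift : Series → Series
shift f n = f (suc n)

infixl 6 _⊖_
infixl 7 _⊛_
infix  8 _!⁻¹

_⊖_ : Series → Series → Series
(f ⊖ g) n = f n - g n

_⊛_ : Series → Series → Series
(f ⊛ g) n = sum {suc n} (λ i → f (toℕ i) * g (n ∸ toℕ i))

-- The coefficients of 1 / f in degrees n, n − 1, …, 0 (in that order).

reciprocals : (f : Series) .{{_ : NonZero (f 0)}} (n : ℕ) → Vec ℚ (suc n)
reciprocals f zero    = 1/ (f 0) ∷ []
reciprocals f (suc n) = 1/ (f 0) * - sum (λ i → f (suc (toℕ i)) * lookup gs i) ∷ gs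
  where gs = reciprocals f n

reciprocal : (f : Series) .{{_ : NonZero (f 0)}} → Series
reciprocal f n = head (reciprocals f n)

lookup-reciprocals : (f : Series) .{{_ : NonZero (f 0)}} (n : ℕ) (i : Fin (suc n)) →
                     lookup (reciprocals f n) i ≡ reciprocal f (n ∸ toℕ i)
lookup-reciprocals f zero    zero    = refl
lookup-reciprocals f (suc n) zero    = refl
lookup-reciprocals f (suc n) (suc i) = lookup-reciprocals f n i

reciprocal-inverse : (f : Series) .{{_ : NonZero (f 0)}} → f ⊛ reciprocal f ≗ 𝟙
reciprocal-inverse f zero    = trans (+-identityʳ _) (*-inverseʳ (f 0))
reciprocal-inverse f (suc n) = begin
  f 0 * (1/ (f 0) * - s) + s′   ≡⟨ cong₂ _+_ (sym (*-assoc (f 0) (1/ (f 0)) (- s))) (sym s≡s′) ⟩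
  f 0 * 1/ (f 0) * - s + s      ≡⟨ cong (λ x → x * - s + s) (*-inverseʳ (f 0)) ⟩
  1ℚ * - s + s                  ≡⟨ cong (_+ s) (*-identityˡ (- s)) ⟩
  - s + s                       ≡⟨ +-inverseˡ s ⟩
  0ℚ                            ∎
  where
  open ≡-Reasoning
  s s′ : ℚ
  s  = sum {suc n} (λ i → f (suc (toℕ i)) * lookup (reciprocals f n) i)
  s′ = sum {suc n} (λ i → f (suc (toℕ i)) * reciprocal f (n ∸ toℕ i))
  s≡s′ : s ≡ s′
  s≡s′ = sum-cong-≗ {suc n} (λ i → cong (f (suc (toℕ i)) *_) (lookup-reciprocals f n i))

_!⁻¹ : ℕ → ℚ
n !⁻¹ = (1ℤ / (n !)) {{n ℕ.!≢0}}

exp : Series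
exp n = n !⁻¹

-- B n / n! is the coefficient of tⁿ in the reciprocal of (eᵗ − 1) / t.
-- In particular B 1 = −1/2.

B : ℕ → ℚ
B n = (+ (n !) / 1) * reciprocal (shift (exp ⊖ 𝟙)) n

egf : (ℕ → ℚ) → Series
egf a n = a n * n !⁻¹

!*!⁻¹ : ∀ n → (+ (n !) / 1) * n !⁻¹ ≡ 1ℚ
!*!⁻¹ n = cancel (n !) {{n ℕ.!≢0}}
  where
  cancel : ∀ m .{{_ : ℕ.NonZero m}} → (+ m / 1) * (1ℤ / m) ≡ 1ℚ
  cancel m@(suc _) = toℚᵘ-injective (begin-equality
    toℚᵘ ((+ m / 1) * (1ℤ / m))        ≃⟨ toℚᵘ-homo-* (+ m / 1) (1ℤ / m) ⟩
    toℚᵘ (+ m / 1) ℚᵘ.* toℚᵘ (1ℤ / m)  ≃⟨ ℚᵘ.*-cong (toℚᵘ-fromℚᵘ (+ m ℚᵘ./ 1)) (toℚᵘ-fromℚᵘ (1ℤ ℚᵘ./ m)) ⟩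
    (+ m ℚᵘ./ 1) ℚᵘ.* (1ℤ ℚᵘ./ m)      ≃⟨ ℚᵘ.*-inverseʳ (+ m ℚᵘ./ 1) ⟩
    ℚᵘ.1ℚᵘ                             ∎)
    where open ℚᵘ.≤-Reasoning

egf-B : egf B ≗ reciprocal (shift (exp ⊖ 𝟙))
egf-B n = begin
  f * r * i     ≡⟨ cong (_* i) (*-comm f r) ⟩
  r * f * i     ≡⟨ *-assoc r f i ⟩
  r * (f * i)   ≡⟨ cong (r *_) (!*!⁻¹ n) ⟩
  r * 1ℚ        ≡⟨ *-identityʳ r ⟩
  r             ∎
  where
  open ≡-Reasoning
  f = + (n !) / 1
  r = reciprocal (shift (exp ⊖ 𝟙)) n
  i = n !⁻¹

-- The defining equation t / (eᵗ − 1) = Σ Bₙ tⁿ / n!, cleared of its denominator.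

B-generatingFunction : (exp ⊖ 𝟙) ⊛ egf B ≗ 𝕥
B-generatingFunction zero    = refl
B-generatingFunction (suc n) = begin
  0ℚ * egf B (suc n) + ((shift (exp ⊖ 𝟙)) ⊛ egf B) n
    ≡⟨ cong₂ _+_ (*-zeroˡ (egf B (suc n)))
         (sum-cong-≗ {suc n} (λ i → cong (shift (exp ⊖ 𝟙) (toℕ i) *_) (egf-B (n ∸ toℕ i)))) ⟩
  0ℚ + (shift (exp ⊖ 𝟙) ⊛ reciprocal (shift (exp ⊖ 𝟙))) n
    ≡⟨ +-identityˡ _ ⟩
  (shift (exp ⊖ 𝟙) ⊛ reciprocal (shift (exp ⊖ 𝟙))) n
    ≡⟨ reciprocal-inverse (shift (exp ⊖ 𝟙)) n ⟩
  𝟙 n ∎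
  where open ≡-Reasoning

harmonic : ℕ → ℚ
harmonic m = sum {m} (λ j → 1ℤ / suc (toℕ j))

Matrix : ℕ → Set
Matrix n = Fin n → Fin n → ℚ

-- Laplace expansion along the first row; punchIn j skips column j.

det : ∀ {n} → Matrix n → ℚ
det {zero}  M = 1ℚ
det {suc n} M = sum (λ j →
  (- 1ℚ) ^ toℕ j * M zero j * det (λ r c → M (suc r) (punchIn j c)))

-- The determinant of size n + 1, not n.

hankel : ℕ → (ℕ → ℚ) → ℚ
hankel n a = det {suc n} (λ i j → a (toℕ i ℕ.+ toℕ j))

n!*[1+n]!³≢0 : ∀ n → ℕ.NonZero (n ! ℕ.* (suc n !) ℕ.^ 3)
n!*[1+n]!³≢0 n =
  ℕ.m*n≢0 (n !) _ {{n ℕ.!≢0}} {{ℕ.m^n≢0 (suc n !) 3 {{suc n ℕ.!≢0}}}}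

{-# OPTIONS --safe #-}
module Submission where

-- Let L be the functional with L(xᵏ) = (2k + 1) B₂ₖ, let φₖ = (1² − x) ⋯ (k² − x), and let J(zᵐ) = m Bₘ₋₁, so
-- that L(p) = J(z p(z²)). The Bernoulli recurrence says J(g(z + 1)) − J(g(z)) = g″(0); applied to
-- g = (z − k − 1) (z − k) ⋯ (z + k), it gives L(φₖ) = k!² / (k + 1). Hence
-- L(x φₖ φⱼ) = (k + 1)! k! (j + 1)! j! / (k + j + 2), a rescaled Hilbert matrix, and a polynomial
-- Q = Σₖ dₖ φₖ / ((k + 1)! k!) of degree n with L(Q xⁱ⁺¹) = 0 for i < n comes from the partial fractions
-- Σₖ dₖ / (t + k) = (t − 2) ⋯ (t − n − 1) / (t (t + 1) ⋯ (t + n)).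
-- Replacing the last column of either Hankel matrix by the corresponding combination of columns leaves one
-- nonzero entry in it, L(Q) at the top or L(Q xⁿ⁺¹) at the bottom, with the same complementary minor. So the
-- ratio of the determinants is (−1)ⁿ L(Q) / L(Q xⁿ⁺¹). The harmonic numbers come from
-- L(Q) = Σₖ dₖ / (k + 1)², a logarithmic derivative at t = 1.

open import Defs
open import Algebra.Bundles using (module CommutativeRing)
open import Data.Fin.Base using (Fin; zero; suc; toℕ; fromℕ; fromℕ<; inject₁; punchIn; punchOut)
open import Data.Fin.Induction using (>-weakInduction)
open import Data.Fin.Properties
  using (_≟_; suc-injective; toℕ<n; toℕ≤pred[n]; toℕ-fromℕ; toℕ-fromℕ<; toℕ-inject₁; fromℕ≢inject₁;
         punchIn-injective; punchIn-punchOut; punchInᵢ≢i)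
open import Data.Integer.Base as ℤ using (+_; 1ℤ)
import Data.Integer.Properties as ℤ
open import Data.Nat.Base as ℕ using (ℕ; zero; suc; _!; _∸_)
import Data.Nat.Properties as ℕ
open import Data.Nat.Solver using () renaming (module +-*-Solver to ℕ-Solver)
open import Data.Product.Base using (∃; _×_; _,_; proj₁; proj₂)
open import Data.Rational.Base using (ℚ; 0ℚ; 1ℚ; _+_; _*_; _-_; _/_; -_; toℚᵘ)
open import Data.Rational.Properties hiding (_≟_)
open import Algebra.Properties.Semiring.Sum (CommutativeRing.semiring +-*-commutativeRing)
  using (∑-distrib-+; *-distribˡ-sum; sum-init-last; sum-replicate-zero)
open import Data.Rational.Solver using (module +-*-Solver)
import Data.Rational.Unnormalised.Base as ℚᵘ
import Data.Rational.Unnormalised.Properties as ℚᵘ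
open import Data.Sum.Base using (_⊎_; inj₁; inj₂)
open import Function.Base using (_∘_)
open import Relation.Binary.PropositionalEquality
open import Relation.Nullary using (yes; no; contradiction)
open +-*-Solver using (solve; con; _:=_; _:+_; _:*_; _:-_; :-_)
open ℕ-Solver using () renaming (solve to solveℕ; con to conℕ; _:=_ to _⊜_; _:+_ to _⊕_; _:*_ to _⊗_)
open ≡-Reasoning

-- Polynomials are never represented. A functional is the sequence of its values on powers, and
-- multiplying its argument by a fixed polynomial is an operator on sequences. The sum over k with
-- weights dₖ and the determinant as a function of its last column are linear maps that commute with
-- such operators. The zeros t = 2, ..., n + 1 are forced: L(Q x φⱼ) is (j + 1)! j! times the
-- rational function at t = j + 2, and it has to vanish for j < n. Comparing the two determinants
-- requires cancelling the leading coefficient of Q. That it is nonzero comes from the second column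
-- replacement itself: the determinant of the shifted sequence times this coefficient equals L(Q
-- xⁿ⁺¹), an explicit nonzero number, times the same determinant one size smaller. By induction on
-- the size both factors on the left are nonzero.

ι : ℕ → ℚ
ι n = + n / 1

/-*-cancel : ∀ p q .{{_ : ℕ.NonZero q}} → (+ p / q) * ι q ≡ ι p
/-*-cancel p q@(suc _) = toℚᵘ-injective (R.begin-equality
  toℚᵘ ((+ p / q) * ι q)            R.≃⟨ toℚᵘ-homo-* (+ p / q) (ι q) ⟩
  toℚᵘ (+ p / q) ℚᵘ.* toℚᵘ (ι q)    R.≃⟨ ℚᵘ.*-cong (toℚᵘ-fromℚᵘ (+ p ℚᵘ./ q)) (toℚᵘ-fromℚᵘ (+ q ℚᵘ./ 1)) ⟩
  (+ p ℚᵘ./ q) ℚᵘ.* (+ q ℚᵘ./ 1)    R.≃⟨ ℚᵘ.*≡* (trans (ℤ.*-identityʳ _) (cong (λ z → + p ℤ.* z)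
      (cong +_ (sym (ℕ.*-identityʳ q))))) ⟩
  + p ℚᵘ./ 1                        R.≃⟨ toℚᵘ-fromℚᵘ (+ p ℚᵘ./ 1) ⟨
  toℚᵘ (ι p)                        R.∎)
  where module R = ℚᵘ.≤-Reasoning

ι-+ : ∀ m n → ι (m ℕ.+ n) ≡ ι m + ι n
ι-+ m n = toℚᵘ-injective (R.begin-equality
  toℚᵘ (ι (m ℕ.+ n))              R.≃⟨ toℚᵘ-fromℚᵘ (+ (m ℕ.+ n) ℚᵘ./ 1) ⟩
  + (m ℕ.+ n) ℚᵘ./ 1              R.≃⟨ ℚᵘ.*≡* (cong₂ ℤ._*_
      (cong₂ ℤ._+_ (sym (ℤ.*-identityʳ (+ m))) (sym (ℤ.*-identityʳ (+ n)))) refl) ⟩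
  (+ m ℚᵘ./ 1) ℚᵘ.+ (+ n ℚᵘ./ 1)  R.≃⟨ ℚᵘ.+-cong (toℚᵘ-fromℚᵘ (+ m ℚᵘ./ 1)) (toℚᵘ-fromℚᵘ (+ n ℚᵘ./ 1)) ⟨
  toℚᵘ (ι m) ℚᵘ.+ toℚᵘ (ι n)      R.≃⟨ toℚᵘ-homo-+ (ι m) (ι n) ⟨
  toℚᵘ (ι m + ι n)                R.∎)
  where module R = ℚᵘ.≤-Reasoning

ι-suc : ∀ n → ι (suc n) ≡ 1ℚ + ι n
ι-suc = ι-+ 1

ι-* : ∀ m n → ι (m ℕ.* n) ≡ ι m * ι n
ι-* zero    n = sym (*-zeroˡ (ι n))
ι-* (suc m) n = begin
  ι (n ℕ.+ m ℕ.* n)    ≡⟨ ι-+ n (m ℕ.* n) ⟩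
  ι n + ι (m ℕ.* n)    ≡⟨ cong (λ z → ι n + z) (ι-* m n) ⟩
  ι n + ι m * ι n      ≡⟨ solve 2 (λ x y → y :+ x :* y := (con 1ℚ :+ x) :* y) refl (ι m) (ι n) ⟩
  (1ℚ + ι m) * ι n     ≡⟨ cong (_* ι n) (ι-suc m) ⟨
  ι (suc m) * ι n      ∎

sum-zero : ∀ {n} (f : Fin n → ℚ) → (∀ i → f i ≡ 0ℚ) → sum f ≡ 0ℚ
sum-zero {n} f f≡0 = trans (sum-cong-≗ f≡0) (sum-replicate-zero n)

-- Determinants as multilinear alternating functions of the columns

minor : ∀ {n} → Fin (suc n) → Matrix (suc n) → Matrix n
minor j M r c = M (suc r) (punchIn j c)

det-cong : ∀ {n} {M N : Matrix n} → (∀ i j → M i j ≡ N i j) → det M ≡ det N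
det-cong {zero}  M≡N = refl
det-cong {suc n} M≡N = sum-cong-≗ λ j →
  cong₂ _*_ (cong ((- 1ℚ) ^ toℕ j *_) (M≡N zero j)) (det-cong λ r c → M≡N (suc r) (punchIn j c))

-- Each term of the expansion meets column `c` exactly once: through its entry when `j` is `c`, and
-- otherwise inside the minor, at position `punchOut j≢c`, where the induction applies.
det-linear : ∀ {n} (c : Fin n) (x y : ℚ) {L M N : Matrix n} →
             (∀ i → L i c ≡ x * M i c + y * N i c) →
             (∀ i j → j ≢ c → L i j ≡ M i j) → (∀ i j → j ≢ c → L i j ≡ N i j) →
             det L ≡ x * det M + y * det N
det-linear {suc n} c x y {L} {M} {N} atc offM offN = begin
  sum (term L)                                              ≡⟨ sum-cong-≗ step ⟩
  sum (λ j → x * term M j + y * term N j)                   ≡⟨ ∑-distrib-+ (λ j → x * term M j)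
      (λ j → y * term N j) ⟩
  sum (λ j → x * term M j) + sum (λ j → y * term N j)       ≡⟨ cong₂ _+_ (*-distribˡ-sum x (term M))
      (*-distribˡ-sum y (term N)) ⟨
  x * det M + y * det N                                     ∎
  where
  term : Matrix (suc n) → Fin (suc n) → ℚ
  term P j = (- 1ℚ) ^ toℕ j * P zero j * det (minor j P)
  step : ∀ j → term L j ≡ x * term M j + y * term N j
  step j with j ≟ c
  ... | yes refl = begin
    s * L zero j * det (minor j L)
      ≡⟨ cong (λ z → s * z * det (minor j L)) (atc zero) ⟩
    s * (x * M zero j + y * N zero j) * det (minor j L)
      ≡⟨ solve 6 (λ s x m y n d → s :* (x :* m :+ y :* n) :* d := x :* (s :* m :* d) :+ y :* (s :* n :* d))
           refl s x (M zero j) y (N zero j) (det (minor j L)) ⟩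
    x * (s * M zero j * det (minor j L)) + y * (s * N zero j * det (minor j L))
      ≡⟨ cong₂ (λ d e → x * (s * M zero j * d) + y * (s * N zero j * e))
           (det-cong λ r d → offM (suc r) (punchIn j d) (punchInᵢ≢i j d))
           (det-cong λ r d → offN (suc r) (punchIn j d) (punchInᵢ≢i j d)) ⟩
    x * term M j + y * term N j ∎
    where
    s = (- 1ℚ) ^ toℕ j
  ... | no j≢c = begin
    s * L zero j * det (minor j L)
      ≡⟨ cong (s * L zero j *_) (det-linear (punchOut j≢c) x y {minor j L} {minor j M} {minor j N}
           (λ i → subst (λ d → L (suc i) d ≡ x * M (suc i) d + y * N (suc i) d) (sym c≡) (atc (suc i)))
           (λ i d d≢ → offM (suc i) (punchIn j d) (off d d≢))
           (λ i d d≢ → offN (suc i) (punchIn j d) (off d d≢))) ⟩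
    s * L zero j * (x * det (minor j M) + y * det (minor j N))
      ≡⟨ solve 6 (λ s l x d y e → s :* l :* (x :* d :+ y :* e) := x :* (s :* l :* d) :+ y :* (s :* l :* e))
           refl s (L zero j) x (det (minor j M)) y (det (minor j N)) ⟩
    x * (s * L zero j * det (minor j M)) + y * (s * L zero j * det (minor j N))
      ≡⟨ cong₂ (λ m n → x * (s * m * det (minor j M)) + y * (s * n * det (minor j N)))
           (offM zero j j≢c) (offN zero j j≢c) ⟩
    x * term M j + y * term N j ∎
    where
    s = (- 1ℚ) ^ toℕ j
    c≡ : punchIn j (punchOut j≢c) ≡ c
    c≡ = punchIn-punchOut j≢c
    off : ∀ d → d ≢ punchOut j≢c → punchIn j d ≢ c
    off d d≢ eq = d≢ (punchIn-injective j d _ (trans eq (sym c≡)))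

det-zero-column : ∀ {n} (c : Fin n) (M : Matrix n) → (∀ i → M i c ≡ 0ℚ) → det M ≡ 0ℚ
det-zero-column c M z = trans
  (det-linear c 0ℚ 0ℚ {M} {M} {M} (λ i → trans (z i) (solve 1 (λ m → con 0ℚ
      := con 0ℚ :* m :+ con 0ℚ :* m) refl (M i c)))
    (λ _ _ _ → refl) (λ _ _ _ → refl))
  (solve 1 (λ m → con 0ℚ :* m :+ con 0ℚ :* m := con 0ℚ) refl (det M))

-- The pattern of the two expansions in `det-swap`: the terms at the swapped columns trade places,
-- all others keep theirs.
sum-antisym : ∀ {n} (c : Fin n) (f g : Fin (suc n) → ℚ) →
              f (inject₁ c) ≡ - g (suc c) → f (suc c) ≡ - g (inject₁ c) →
              (∀ j → j ≢ inject₁ c → j ≢ suc c → f j ≡ - g j) → sum f ≡ - sum g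
sum-antisym {suc n} zero f g p q r = begin
  f zero + (f (suc zero) + sum (λ j → f (suc (suc j))))
    ≡⟨ cong₂ _+_ p (cong₂ _+_ q (sum-neg (λ j → f (suc (suc j))) (λ j → g (suc (suc j))) λ j → r (suc (suc j))
        (λ ()) (λ ()))) ⟩
  - g (suc zero) + (- g zero + - sum (λ j → g (suc (suc j))))
    ≡⟨ solve 3 (λ x y z → :- y :+ (:- x :+ :- z) := :- (x :+ (y :+ z))) refl (g zero) (g (suc zero)) _ ⟩
  - sum g ∎
  where
  sum-neg : ∀ {n} (f g : Fin n → ℚ) → (∀ j → f j ≡ - g j) → sum f ≡ - sum g
  sum-neg {zero}  f g e = refl
  sum-neg {suc n} f g e = trans (cong₂ _+_ (e zero) (sum-neg (f ∘ suc) (g ∘ suc) (e ∘ suc)))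
    (sym (neg-distrib-+ (g zero) _))
sum-antisym {suc n} (suc c) f g p q r = trans
  (cong₂ _+_ (r zero (λ ()) (λ ())) (sum-antisym c (f ∘ suc) (g ∘ suc) p q
    λ j j≢ j≢′ → r (suc j) (j≢ ∘ suc-injective) (j≢′ ∘ suc-injective)))
  (sym (neg-distrib-+ (g zero) _))

-- Deleting a third column leaves two neighbours adjacent, so the minor is again an instance of
-- `det-swap`.
punchIn-adjacent : ∀ {n} (j : Fin (suc (suc n))) (c : Fin (suc n)) → j ≢ inject₁ c → j ≢ suc c →
                   ∃ λ (d : Fin n) → punchIn j (inject₁ d) ≡ inject₁ c × punchIn j (suc d) ≡ suc c
punchIn-adjacent zero zero j≢ j≢′ = contradiction refl j≢
punchIn-adjacent zero (suc c) j≢ j≢′ = c , refl , refl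
punchIn-adjacent (suc zero) zero j≢ j≢′ = contradiction refl j≢′
punchIn-adjacent {suc n} (suc (suc j)) zero j≢ j≢′ = zero , refl , refl
punchIn-adjacent {suc n} (suc j) (suc c) j≢ j≢′
  with d , p , q ← punchIn-adjacent j c (j≢ ∘ cong suc) (j≢′ ∘ cong suc) = suc d , cong suc p , cong suc q

-- Compares the minors without column c and without column c + 1: they differ in one position only,
-- where each shows the column that the other has lost.
punchIn-inject₁-suc : ∀ {n} (c d : Fin n) →
  punchIn (inject₁ c) d ≡ suc c × punchIn (suc c) d ≡ inject₁ c ⊎
  punchIn (inject₁ c) d ≡ punchIn (suc c) d × punchIn (suc c) d ≢ inject₁ c × punchIn (suc c) d ≢ suc c
punchIn-inject₁-suc zero zero = inj₁ (refl , refl)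
punchIn-inject₁-suc zero (suc d) = inj₂ (refl , (λ ()) , (λ ()))
punchIn-inject₁-suc (suc c) zero = inj₂ (refl , (λ ()) , (λ ()))
punchIn-inject₁-suc (suc c) (suc d) with punchIn-inject₁-suc c d
... | inj₁ (p , q) = inj₁ (cong suc p , cong suc q)
... | inj₂ (p , q , r) = inj₂ (cong suc p , q ∘ suc-injective , r ∘ suc-injective)

-- Deleting one column of the pair from `M` and the other from `N` gives the same minor, with
-- opposite signs because the positions differ by one. All other terms change sign by induction.
det-swap : ∀ {n} (c : Fin n) {M N : Matrix (suc n)} →
           (∀ i → M i (inject₁ c) ≡ N i (suc c)) → (∀ i → M i (suc c) ≡ N i (inject₁ c)) →
           (∀ i j → j ≢ inject₁ c → j ≢ suc c → M i j ≡ N i j) → det M ≡ - det N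
det-swap {suc n} c {M} {N} p q r = sum-antisym c (term M) (term N) left right off
  where
  term : Matrix (suc (suc n)) → Fin (suc (suc n)) → ℚ
  term P j = (- 1ℚ) ^ toℕ j * P zero j * det (minor j P)
  minorˡ : ∀ i d → minor (inject₁ c) M i d ≡ minor (suc c) N i d
  minorˡ i d with punchIn-inject₁-suc c d
  ... | inj₁ (e , f) = trans (cong (M (suc i)) e) (trans (q (suc i)) (cong (N (suc i)) (sym f)))
  ... | inj₂ (e , f , g) = trans (cong (M (suc i)) e) (r (suc i) _ f g)
  minorʳ : ∀ i d → minor (suc c) M i d ≡ minor (inject₁ c) N i d
  minorʳ i d with punchIn-inject₁-suc c d
  ... | inj₁ (e , f) = trans (cong (M (suc i)) f) (trans (p (suc i)) (cong (N (suc i)) (sym e)))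
  ... | inj₂ (e , f , g) = trans (r (suc i) _ f g) (cong (N (suc i)) (sym e))
  left : term M (inject₁ c) ≡ - term N (suc c)
  left = begin
    (- 1ℚ) ^ toℕ (inject₁ c) * M zero (inject₁ c) * det (minor (inject₁ c) M)
      ≡⟨ cong₂ _*_ (cong₂ _*_ (cong ((- 1ℚ) ^_) (toℕ-inject₁ c)) (p zero)) (det-cong minorˡ) ⟩
    (- 1ℚ) ^ toℕ c * N zero (suc c) * det (minor (suc c) N)
      ≡⟨ solve 3 (λ s n d → s :* n :* d
          := :- (:- con 1ℚ :* s :* n :* d)) refl ((- 1ℚ) ^ toℕ c) (N zero (suc c)) _ ⟩
    - term N (suc c) ∎
  right : term M (suc c) ≡ - term N (inject₁ c)
  right = begin
    - 1ℚ * (- 1ℚ) ^ toℕ c * M zero (suc c) * det (minor (suc c) M)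
      ≡⟨ solve 3 (λ s n d → :- con 1ℚ :* s :* n :* d
          := :- (s :* n :* d)) refl ((- 1ℚ) ^ toℕ c) (M zero (suc c)) _ ⟩
    - ((- 1ℚ) ^ toℕ c * M zero (suc c) * det (minor (suc c) M))
      ≡⟨ cong -_ (cong₂ _*_ (cong₂ _*_ (cong ((- 1ℚ) ^_) (sym (toℕ-inject₁ c))) (q zero)) (det-cong minorʳ)) ⟩
    - term N (inject₁ c) ∎
  off : ∀ j → j ≢ inject₁ c → j ≢ suc c → term M j ≡ - term N j
  off j j≢ j≢′ with d , e , f ← punchIn-adjacent j c j≢ j≢′ = begin
    s * M zero j * det (minor j M)
      ≡⟨ cong₂ (λ m d → s * m * d) (r zero j j≢ j≢′) (det-swap d {minor j M} {minor j N}
          (λ i → trans (cong (M (suc i)) e) (trans (p (suc i)) (cong (N (suc i)) (sym f))))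
          (λ i → trans (cong (M (suc i)) f) (trans (q (suc i)) (cong (N (suc i)) (sym e))))
          (λ i k k≢ k≢′ → r (suc i) (punchIn j k)
            (λ g → k≢ (punchIn-injective j k _ (trans g (sym e))))
            (λ g → k≢′ (punchIn-injective j k _ (trans g (sym f)))))) ⟩
    s * N zero j * - det (minor j N)
      ≡⟨ solve 3 (λ s n d → s :* n :* :- d := :- (s :* n :* d)) refl s (N zero j) _ ⟩
    - term N j ∎
    where s = (- 1ℚ) ^ toℕ j

x≡-x⇒x≡0 : ∀ {x} → x ≡ - x → x ≡ 0ℚ
x≡-x⇒x≡0 {x} e = begin
  x                    ≡⟨ solve 1 (λ x → x := con (1ℤ / 2) :* (x :+ x)) refl x ⟩
  (1ℤ / 2) * (x + x)   ≡⟨ cong (λ y → (1ℤ / 2) * (x + y)) e ⟩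
  (1ℤ / 2) * (x - x)   ≡⟨ solve 1 (λ x → con (1ℤ / 2) :* (x :- x) := con 0ℚ) refl x ⟩
  0ℚ                   ∎

transpose₁ : ∀ {n} → Fin n → Fin (suc n) → Fin (suc n)
transpose₁ zero    zero          = suc zero
transpose₁ zero    (suc zero)    = zero
transpose₁ zero    (suc (suc j)) = suc (suc j)
transpose₁ (suc c) zero          = zero
transpose₁ (suc c) (suc j)       = suc (transpose₁ c j)

transpose₁-inject₁ : ∀ {n} (c : Fin n) → transpose₁ c (inject₁ c) ≡ suc c
transpose₁-inject₁ zero    = refl
transpose₁-inject₁ (suc c) = cong suc (transpose₁-inject₁ c)

transpose₁-suc : ∀ {n} (c : Fin n) → transpose₁ c (suc c) ≡ inject₁ c
transpose₁-suc zero    = refl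
transpose₁-suc (suc c) = cong suc (transpose₁-suc c)

transpose₁-fixed : ∀ {n} (c : Fin n) j → j ≢ inject₁ c → j ≢ suc c → transpose₁ c j ≡ j
transpose₁-fixed zero    zero          j≢ j≢′ = contradiction refl j≢
transpose₁-fixed zero    (suc zero)    j≢ j≢′ = contradiction refl j≢′
transpose₁-fixed zero    (suc (suc j)) j≢ j≢′ = refl
transpose₁-fixed (suc c) zero          j≢ j≢′ = refl
transpose₁-fixed (suc c) (suc j)       j≢ j≢′ = cong suc (transpose₁-fixed c j (j≢ ∘ cong suc) (j≢′ ∘ cong suc))

-- Downward induction on `c`: adjacent swaps carry the copy to the right until it is next to the
-- last column. There the swap leaves the matrix unchanged, so the determinant is its own negative.
det-repeated-last : ∀ {n} (c : Fin n) (M : Matrix (suc n)) → (∀ i → M i (inject₁ c) ≡ M i (fromℕ n)) →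
    det M ≡ 0ℚ
det-repeated-last {suc n} c = >-weakInduction Repeated adjacent move c
  where
  Repeated : Fin (suc n) → Set
  Repeated c = ∀ (M : Matrix (suc (suc n))) → (∀ i → M i (inject₁ c) ≡ M i (fromℕ (suc n))) → det M ≡ 0ℚ
  adjacent : Repeated (fromℕ n)
  adjacent M eq = x≡-x⇒x≡0 (det-swap (fromℕ n) {M} {M} eq (sym ∘ eq) (λ _ _ _ _ → refl))
  move : ∀ i → Repeated (suc i) → Repeated (inject₁ i)
  move i rep M eq = begin
    det M      ≡⟨ det-swap c′ {M} {N}
                    (λ r → cong (M r) (sym (transpose₁-suc c′)))
                    (λ r → cong (M r) (sym (transpose₁-inject₁ c′)))
                    (λ r j j≢ j≢′ → cong (M r) (sym (transpose₁-fixed c′ j j≢ j≢′))) ⟩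
    - det N    ≡⟨ cong -_ (rep N λ r → trans (cong (M r) (transpose₁-suc c′))
                    (trans (eq r) (cong (M r) (sym (transpose₁-fixed c′ (fromℕ (suc n)) fromℕ≢inject₁
                      (λ e → fromℕ≢inject₁ (suc-injective e))))))) ⟩
    0ℚ         ∎
    where
    c′ = inject₁ i
    N : Matrix (suc (suc n))
    N r j = M r (transpose₁ c′ j)

punchIn-inject₁ : ∀ {n} (j : Fin (suc n)) (k : Fin n) → punchIn (inject₁ j) (inject₁ k) ≡ inject₁ (punchIn j k)
punchIn-inject₁ zero    k       = refl
punchIn-inject₁ (suc j) zero    = refl
punchIn-inject₁ (suc j) (suc k) = cong suc (punchIn-inject₁ j k)

punchIn-inject₁-fromℕ : ∀ {n} (j : Fin (suc n)) → punchIn (inject₁ j) (fromℕ n) ≡ fromℕ (suc n)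
punchIn-inject₁-fromℕ zero = refl
punchIn-inject₁-fromℕ {suc n} (suc j) = cong suc (punchIn-inject₁-fromℕ j)

punchIn-fromℕ : ∀ {n} (k : Fin n) → punchIn (fromℕ n) k ≡ inject₁ k
punchIn-fromℕ zero    = refl
punchIn-fromℕ (suc k) = cong suc (punchIn-fromℕ k)

-- Every minor that keeps the last column has a zero column, so a single term of the expansion
-- survives.
det-last-column-top : ∀ {n} (M : Matrix (suc n)) → (∀ i → M (suc i) (fromℕ n) ≡ 0ℚ) →
                      det M ≡ (- 1ℚ) ^ n * M zero (fromℕ n) * det (λ r c → M (suc r) (inject₁ c))
det-last-column-top {n} M z = begin
  sum term ≡⟨ sum-init-last term ⟩
  sum (term ∘ inject₁) + term (fromℕ n) ≡⟨ cong (_+ term (fromℕ n)) (sum-zero (term ∘ inject₁) vanish) ⟩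
  0ℚ + term (fromℕ n) ≡⟨ +-identityˡ _ ⟩
  term (fromℕ n) ≡⟨ cong₂ (λ k d → (- 1ℚ) ^ k * M zero (fromℕ n) * d) (toℕ-fromℕ n)
                     (det-cong λ r c → cong (M (suc r)) (punchIn-fromℕ c)) ⟩
  (- 1ℚ) ^ n * M zero (fromℕ n) * det (λ r c → M (suc r) (inject₁ c)) ∎
  where
  term : Fin (suc n) → ℚ
  term j = (- 1ℚ) ^ toℕ j * M zero j * det (minor j M)
  zero-column : ∀ {m} (N : Matrix (suc m)) → (∀ i → N (suc i) (fromℕ m) ≡ 0ℚ) → ∀ (j : Fin m) →
      det (minor (inject₁ j) N) ≡ 0ℚ
  zero-column {suc m} N z j = det-zero-column (fromℕ m) (minor (inject₁ j) N) λ i → trans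
      (cong (N (suc i)) (punchIn-inject₁-fromℕ j)) (z i)
  vanish : ∀ j → term (inject₁ j) ≡ 0ℚ
  vanish j = trans (cong ((- 1ℚ) ^ toℕ (inject₁ j) * M zero (inject₁ j) *_) (zero-column M z j)) (*-zeroʳ
      ((- 1ℚ) ^ toℕ (inject₁ j) * M zero (inject₁ j)))

-- The expansion runs along the first row, so the corner is reached by induction: the last term has
-- entry 0, and every other minor has the same shape and the same corner.
det-last-column-bottom : ∀ {n} (M : Matrix (suc n)) → (∀ i → M (inject₁ i) (fromℕ n) ≡ 0ℚ) →
                         det M ≡ M (fromℕ n) (fromℕ n) * det (λ r c → M (inject₁ r) (inject₁ c))
det-last-column-bottom {zero} M z = solve 1 (λ m → con 1ℚ :* m :* con 1ℚ :+ con 0ℚ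
    := m :* con 1ℚ) refl (M zero zero)
det-last-column-bottom {suc n} M z = begin
  sum term                                      ≡⟨ sum-init-last term ⟩
  sum (term ∘ inject₁) + term (fromℕ (suc n))   ≡⟨ cong₂ _+_
      (trans (sum-cong-≗ step) (sym (*-distribˡ-sum h term′))) lastTerm ⟩
  h * sum term′ + 0ℚ                            ≡⟨ +-identityʳ _ ⟩
  h * sum term′                                 ∎
  where
  h = M (fromℕ (suc n)) (fromℕ (suc n))
  M′ : Matrix (suc n)
  M′ r c = M (inject₁ r) (inject₁ c)
  term : Fin (suc (suc n)) → ℚ
  term j = (- 1ℚ) ^ toℕ j * M zero j * det (minor j M)
  term′ : Fin (suc n) → ℚ
  term′ j = (- 1ℚ) ^ toℕ j * M′ zero j * det (minor j M′)
  lastTerm : term (fromℕ (suc n)) ≡ 0ℚ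
  lastTerm = trans (cong (λ x → (- 1ℚ) ^ toℕ (fromℕ (suc n)) * x * det (minor (fromℕ (suc n)) M)) (z zero))
    (solve 2 (λ s d → s :* con 0ℚ :* d := con 0ℚ) refl ((- 1ℚ) ^ toℕ (fromℕ (suc n))) _)
  step : ∀ j → term (inject₁ j) ≡ h * term′ j
  step j = begin
    (- 1ℚ) ^ toℕ (inject₁ j) * m * det (minor (inject₁ j) M)
      ≡⟨ cong₂ (λ k d → (- 1ℚ) ^ k * m * d) (toℕ-inject₁ j)
          (det-last-column-bottom (minor (inject₁ j) M)
            λ i → trans (cong (M (suc (inject₁ i))) (punchIn-inject₁-fromℕ j)) (z (suc i))) ⟩
    (- 1ℚ) ^ toℕ j * m * (M (fromℕ (suc n)) (punchIn (inject₁ j) (fromℕ n)) * det (λ r c → minor (inject₁ j) M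
        (inject₁ r) (inject₁ c)))
      ≡⟨ cong₂ (λ x d → (- 1ℚ) ^ toℕ j * m * (x * d)) (cong (M (fromℕ (suc n))) (punchIn-inject₁-fromℕ j))
           (det-cong λ r c → cong (M (suc (inject₁ r))) (punchIn-inject₁ j c)) ⟩
    (- 1ℚ) ^ toℕ j * m * (h * det (minor j M′))
      ≡⟨ solve 4 (λ s m h d → s :* m :* (h :* d) := h :* (s :* m :* d)) refl ((- 1ℚ) ^ toℕ j) m h _ ⟩
    h * term′ j ∎
    where m = M zero (inject₁ j)

-- Hankel matrices with the last column replaced

-- Columns 0, ..., n - 1 of the infinite Hankel matrix of `a`, then `f` in place of column n. Rows
-- are cut off only in `borderedMatrix`.
columns : ∀ n → Series → Series → Fin (suc n) → Series
columns zero    a f zero    = f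
columns (suc n) a f zero    = a
columns (suc n) a f (suc j) = columns n (shift a) f j

columns-fromℕ : ∀ n a f → columns n a f (fromℕ n) ≡ f
columns-fromℕ zero    a f = refl
columns-fromℕ (suc n) a f = columns-fromℕ n (shift a) f

columns-inject₁ : ∀ n a f (j : Fin n) i → columns n a f (inject₁ j) i ≡ a (i ℕ.+ toℕ j)
columns-inject₁ (suc n) a f zero    i = cong a (sym (ℕ.+-identityʳ i))
columns-inject₁ (suc n) a f (suc j) i = trans (columns-inject₁ n (shift a) f j i)
    (cong a (sym (ℕ.+-suc i (toℕ j))))

columns-≢ : ∀ n a f g (j : Fin (suc n)) → j ≢ fromℕ n → columns n a f j ≡ columns n a g j
columns-≢ zero    a f g zero    j≢ = contradiction refl j≢
columns-≢ (suc n) a f g zero    j≢ = refl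
columns-≢ (suc n) a f g (suc j) j≢ = columns-≢ n (shift a) f g j (j≢ ∘ cong suc)

columns-cong : ∀ n a {f g} → f ≗ g → ∀ j → columns n a f j ≗ columns n a g j
columns-cong zero    a f≗g zero    = f≗g
columns-cong (suc n) a f≗g zero    = λ _ → refl
columns-cong (suc n) a f≗g (suc j) = columns-cong n (shift a) f≗g j

columns-hankel : ∀ n a (j : Fin (suc n)) i → columns n a (λ i → a (i ℕ.+ n)) j i ≡ a (i ℕ.+ toℕ j)
columns-hankel zero    a zero    i = refl
columns-hankel (suc n) a zero    i = cong a (sym (ℕ.+-identityʳ i))
columns-hankel (suc n) a (suc j) i = begin
  columns n (shift a) (λ i → a (i ℕ.+ suc n)) j i
    ≡⟨ columns-cong n (shift a) (λ i → cong a (ℕ.+-suc i n)) j i ⟩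
  columns n (shift a) (λ i → a (suc (i ℕ.+ n))) j i
    ≡⟨ columns-hankel n (shift a) j i ⟩
  a (suc (i ℕ.+ toℕ j))
    ≡⟨ cong a (ℕ.+-suc i (toℕ j)) ⟨
  a (i ℕ.+ suc (toℕ j)) ∎

borderedMatrix : ∀ n → Series → Series → Matrix (suc n)
borderedMatrix n a f i j = columns n a f j (toℕ i)

bordered : ℕ → Series → Series → ℚ
bordered n a f = det (borderedMatrix n a f)

-- Pointwise equality of sequences is not propositional equality here, so respecting it is a
-- separate field.
record IsLinear (T : Series → ℚ) : Set where
  field
    ≗-cong : ∀ {f g} → f ≗ g → T f ≡ T g
    linear : ∀ x y f g → T (λ i → x * f i + y * g i) ≡ x * T f + y * T g
open IsLinear

bordered-linear : ∀ n a → IsLinear (bordered n a)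
bordered-linear n a .≗-cong f≗g = det-cong λ i j → columns-cong n a f≗g j (toℕ i)
bordered-linear n a .linear x y f g = det-linear (fromℕ n) x y
  (λ i → begin
    columns n a h (fromℕ n) (toℕ i)       ≡⟨ cong-app (columns-fromℕ n a h) (toℕ i) ⟩
    x * f (toℕ i) + y * g (toℕ i)         ≡⟨ cong₂ (λ f g → x * f (toℕ i) + y * g (toℕ i))
        (columns-fromℕ n a f) (columns-fromℕ n a g) ⟨
    x * columns n a f (fromℕ n) (toℕ i) + y * columns n a g (fromℕ n) (toℕ i) ∎)
  (λ i j j≢ → cong-app (columns-≢ n a h f j j≢) (toℕ i))
  (λ i j j≢ → cong-app (columns-≢ n a h g j j≢) (toℕ i))
  where
  h : Series
  h i = x * f i + y * g i

-- As a functional on polynomials, `δ n` reads off the coefficient of xⁿ.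
δ : ℕ → Series
δ zero    = 𝟙
δ (suc n) zero    = 0ℚ
δ (suc n) (suc j) = δ n j

δ-< : ∀ {n j} → j ℕ.< n → δ n j ≡ 0ℚ
δ-< {suc n} {zero}  _            = refl
δ-< {suc n} {suc j} (ℕ.s≤s j<n) = δ-< j<n

δ-≡ : ∀ n → δ n n ≡ 1ℚ
δ-≡ zero    = refl
δ-≡ (suc n) = δ-≡ n

-- For j < n the border repeats column j; for j = n it restores the Hankel matrix.
bordered-shift : ∀ n a j → j ℕ.≤ n → bordered n a (λ i → a (i ℕ.+ j)) ≡ hankel n a * δ n j
bordered-shift n a j j≤n with ℕ.m≤n⇒m<n∨m≡n j≤n
... | inj₂ refl = begin
  bordered n a (λ i → a (i ℕ.+ n))   ≡⟨ det-cong (λ i j → columns-hankel n a j (toℕ i)) ⟩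
  hankel n a                         ≡⟨ *-identityʳ _ ⟨
  hankel n a * 1ℚ                    ≡⟨ cong (hankel n a *_) (δ-≡ n) ⟨
  hankel n a * δ n n                 ∎
... | inj₁ j<n = begin
  bordered n a (λ i → a (i ℕ.+ j))   ≡⟨ det-repeated-last c (borderedMatrix n a f) repeated ⟩
  0ℚ                                 ≡⟨ *-zeroʳ (hankel n a) ⟨
  hankel n a * 0ℚ                    ≡⟨ cong (hankel n a *_) (δ-< j<n) ⟨
  hankel n a * δ n j                 ∎
  where
  c : Fin n
  c = fromℕ< j<n
  f : Series
  f i = a (i ℕ.+ j)
  repeated : ∀ (i : Fin (suc n)) → columns n a f (inject₁ c) (toℕ i) ≡ columns n a f (fromℕ n) (toℕ i)
  repeated i = begin
    columns n a f (inject₁ c) (toℕ i)  ≡⟨ columns-inject₁ n a f c (toℕ i) ⟩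
    a (toℕ i ℕ.+ toℕ c)                ≡⟨ cong (λ j → a (toℕ i ℕ.+ j)) (toℕ-fromℕ< j<n) ⟩
    f (toℕ i)                          ≡⟨ cong-app (columns-fromℕ n a f) (toℕ i) ⟨
    columns n a f (fromℕ n) (toℕ i)    ∎

-- Indexed by the size, unlike `hankel`, so that the minor left for n = 0 is the empty determinant
-- 1.
hankelOfSize : ℕ → Series → ℚ
hankelOfSize n a = det {n} (λ i j → a (toℕ i ℕ.+ toℕ j))

bordered-top : ∀ n a f → (∀ i → i ℕ.< n → f (suc i) ≡ 0ℚ) →
               bordered n a f ≡ (- 1ℚ) ^ n * f 0 * hankelOfSize n (shift a)
bordered-top n a f z = begin
  bordered n a f
    ≡⟨ det-last-column-top (borderedMatrix n a f) (λ i → trans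
        (cong-app last (suc (toℕ i))) (z (toℕ i) (toℕ<n i))) ⟩
  (- 1ℚ) ^ n * columns n a f (fromℕ n) 0 * det {n} (λ i j → columns n a f (inject₁ j) (suc (toℕ i)))
    ≡⟨ cong₂ (λ x d → (- 1ℚ) ^ n * x * d) (cong-app last 0)
         (det-cong {n} λ i j → columns-inject₁ n a f j (suc (toℕ i))) ⟩
  (- 1ℚ) ^ n * f 0 * hankelOfSize n (shift a) ∎
  where
  last : columns n a f (fromℕ n) ≡ f
  last = columns-fromℕ n a f

-- Removing the bottom row leaves the Hankel matrix of `a` itself. With `shift a` in place of `a`
-- this is the minor of `bordered-top`.
bordered-bottom : ∀ n a f → (∀ i → i ℕ.< n → f i ≡ 0ℚ) → bordered n a f ≡ f n * hankelOfSize n a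
bordered-bottom n a f z = begin
  bordered n a f
    ≡⟨ det-last-column-bottom (borderedMatrix n a f) (λ i → trans (cong-app last (toℕ (inject₁ i)))
         (trans (cong f (toℕ-inject₁ i)) (z (toℕ i) (toℕ<n i)))) ⟩
  columns n a f (fromℕ n) (toℕ (fromℕ n)) * det {n} (λ i j → columns n a f (inject₁ j) (toℕ (inject₁ i)))
    ≡⟨ cong₂ _*_ (trans (cong-app last (toℕ (fromℕ n))) (cong f (toℕ-fromℕ n)))
         (det-cong {n} λ i j → trans (columns-inject₁ n a f j (toℕ (inject₁ i)))
            (cong (λ r → a (r ℕ.+ toℕ j)) (toℕ-inject₁ i))) ⟩
  f n * hankelOfSize n a ∎
  where
  last : columns n a f (fromℕ n) ≡ f
  last = columns-fromℕ n a f

-- Multiplication by φₖ on functionals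

-- If f i = L(xⁱ) for a linear functional L, then φ k f i = L(φₖ(x) xⁱ) with φₖ(x) = (1² − x) ⋯ (k² − x).

φ : ℕ → Series → Series
φ zero    f i = f i
φ (suc k) f i = ι (suc k) * ι (suc k) * φ k f i - φ k f (suc i)

φ-linear : ∀ k i → IsLinear (λ f → φ k f i)
φ-linear zero    i .≗-cong e = e i
φ-linear (suc k) i .≗-cong e =
  cong₂ (λ x y → ι (suc k) * ι (suc k) * x - y) (φ-linear k i .≗-cong e) (φ-linear k (suc i) .≗-cong e)
φ-linear zero    i .linear x y f g = refl
φ-linear (suc k) i .linear x y f g = trans
  (cong₂ (λ x y → ι (suc k) * ι (suc k) * x - y) (φ-linear k i .linear x y f g) (φ-linear k
      (suc i) .linear x y f g))
  (solve 7 (λ s x y a b c d → s :* (x :* a :+ y :* b) :- (x :* c :+ y :* d)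
      := x :* (s :* a :- c) :+ y :* (s :* b :- d)) refl
    (ι (suc k) * ι (suc k)) x y (φ k f i) (φ k g i) (φ k f (suc i)) (φ k g (suc i)))

φ-shift : ∀ k f i → φ k (shift f) i ≡ φ k f (suc i)
φ-shift zero    f i = refl
φ-shift (suc k) f i = cong₂ (λ x y → ι (suc k) * ι (suc k) * x - y) (φ-shift k f i) (φ-shift k f (suc i))

-- φₖ has degree k. The bound matters because `bordered-shift` is available only for exponents up to
-- n.
φ-local : ∀ k {n f g} → (∀ j → j ℕ.≤ n → f j ≡ g j) → ∀ i → i ℕ.+ k ℕ.≤ n → φ k f i ≡ φ k g i
φ-local zero    {n} e i i+k≤n = e i (subst (ℕ._≤ n) (ℕ.+-identityʳ i) i+k≤n)
φ-local (suc k) {n} e i i+k≤n = cong₂ (λ x y → ι (suc k) * ι (suc k) * x - y)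
  (φ-local k e i (ℕ.≤-trans (ℕ.n≤1+n _) p)) (φ-local k e (suc i) p)
  where
  p : suc (i ℕ.+ k) ℕ.≤ n
  p = subst (ℕ._≤ n) (ℕ.+-suc i k) i+k≤n

φ-scale : ∀ k x f i → φ k (λ i → x * f i) i ≡ x * φ k f i
φ-scale zero    x f i = refl
φ-scale (suc k) x f i = trans
  (cong₂ (λ x y → ι (suc k) * ι (suc k) * x - y) (φ-scale k x f i) (φ-scale k x f (suc i)))
  (solve 4 (λ s x a b → s :* (x :* a) :- x :* b := x :* (s :* a :- b)) refl (ι (suc k) * ι (suc k)) x _ _)

linear-minus : ∀ {T} → IsLinear T → ∀ x f g → T (λ i → x * f i - g i) ≡ x * T f - T g
linear-minus {T} T-lin x f g = begin
  T (λ i → x * f i - g i)             ≡⟨ T-lin .≗-cong (λ i → minus x (f i) (g i)) ⟩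
  T (λ i → x * f i + - 1ℚ * g i)      ≡⟨ T-lin .linear x (- 1ℚ) f g ⟩
  x * T f + - 1ℚ * T g                ≡⟨ minus x (T f) (T g) ⟨
  x * T f - T g                       ∎
  where
  minus : ∀ x a b → x * a - b ≡ x * a + - 1ℚ * b
  minus = solve 3 (λ x a b → x :* a :- b := x :* a :+ :- con 1ℚ :* b) refl

linear-φ : ∀ {T} → IsLinear T → ∀ k f j → T (λ i → φ k f (i ℕ.+ j)) ≡ φ k (λ j → T (λ i → f (i ℕ.+ j))) j
linear-φ T-lin zero    f j = refl
linear-φ {T} T-lin (suc k) f j = begin
  T (λ i → s * φ k f (i ℕ.+ j) - φ k f (suc i ℕ.+ j))
    ≡⟨ linear-minus T-lin s (λ i → φ k f (i ℕ.+ j)) (λ i → φ k f (suc i ℕ.+ j)) ⟩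
  s * T (λ i → φ k f (i ℕ.+ j)) - T (λ i → φ k f (suc i ℕ.+ j))
    ≡⟨ cong₂ (λ x y → s * x - y) (linear-φ T-lin k f j)
         (trans (T-lin .≗-cong λ i → cong (φ k f) (sym (ℕ.+-suc i j))) (linear-φ T-lin k f (suc j))) ⟩
  φ (suc k) (λ j → T (λ i → f (i ℕ.+ j))) j ∎
  where
  s = ι (suc k) * ι (suc k)

-- The border is a combination of shifted copies of `a`, of which only the copy shifted by n
-- contributes; `φ k (δ n) 0` is the coefficient of xⁿ in φₖ.
bordered-φ : ∀ n a k → k ℕ.≤ n → bordered n a (φ k a) ≡ hankel n a * φ k (δ n) 0
bordered-φ n a k k≤n = begin
  bordered n a (φ k a)
    ≡⟨ bordered-linear n a .≗-cong (λ i → cong (φ k a) (sym (ℕ.+-identityʳ i))) ⟩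
  bordered n a (λ i → φ k a (i ℕ.+ 0))
    ≡⟨ linear-φ (bordered-linear n a) k a 0 ⟩
  φ k (λ j → bordered n a (λ i → a (i ℕ.+ j))) 0
    ≡⟨ φ-local k (bordered-shift n a) 0 k≤n ⟩
  φ k (λ j → hankel n a * δ n j) 0
    ≡⟨ φ-scale k (hankel n a) (δ n) 0 ⟩
  hankel n a * φ k (δ n) 0 ∎

-- Partial fractions and their values

recip : ℕ → ℚ
recip m = 1ℤ / suc m

recip-inverse : ∀ m → recip m * ι (suc m) ≡ 1ℚ
recip-inverse m = /-*-cancel 1 (suc m)

-- Φ n f = Σ_{k ≤ n} dₖ f(k), where dₖ is the residue at t = − k of
-- (t − 2) ⋯ (t − n − 1) / (t (t + 1) ⋯ (t + n)). The step multiplies this rational function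
-- by (t − n − 2) / (t + n + 1), which splits each 1 / (t + k) into partial fractions.

Φ : ℕ → (ℕ → ℚ) → ℚ
Φ zero    f = f 0
Φ (suc n) f = Φ n (λ k → recip (n ∸ k) * (ι (3 ℕ.+ n ℕ.+ n) * f (suc n) - ι (2 ℕ.+ n ℕ.+ k) * f k))

Φ-cong : ∀ n {f g} → (∀ k → k ℕ.≤ n → f k ≡ g k) → Φ n f ≡ Φ n g
Φ-cong zero    e = e 0 ℕ.≤-refl
Φ-cong (suc n) e = Φ-cong n λ k k≤n →
  cong₂ (λ x y → recip (n ∸ k) * (ι (3 ℕ.+ n ℕ.+ n) * x - ι (2 ℕ.+ n ℕ.+ k) * y)) (e (suc n) ℕ.≤-refl) (e k
      (ℕ.m≤n⇒m≤1+n k≤n))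

Φ-linear : ∀ n → IsLinear (Φ n)
Φ-linear n .≗-cong e = Φ-cong n (λ k _ → e k)
Φ-linear zero    .linear x y f g = refl
Φ-linear (suc n) .linear x y f g = trans
  (Φ-linear n .≗-cong λ k → solve 9 (λ r s t x y a b c d →
      r :* (s :* (x :* a :+ y :* b) :- t :* (x :* c :+ y :* d))
          := x :* (r :* (s :* a :- t :* c)) :+ y :* (r :* (s :* b :- t :* d)))
    refl (recip (n ∸ k)) (ι (3 ℕ.+ n ℕ.+ n)) (ι (2 ℕ.+ n ℕ.+ k)) x y (f (suc n)) (g (suc n)) (f k) (g k))
  (Φ-linear n .linear x y _ _)

linear-scale : ∀ {T} → IsLinear T → ∀ x f → T (λ i → x * f i) ≡ x * T f
linear-scale {T} T-lin x f = begin
  T (λ i → x * f i)                ≡⟨ T-lin .≗-cong (λ i → pad x (f i)) ⟩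
  T (λ i → x * f i + 0ℚ * f i)     ≡⟨ T-lin .linear x 0ℚ f f ⟩
  x * T f + 0ℚ * T f               ≡⟨ pad x (T f) ⟨
  x * T f                          ∎
  where
  pad : ∀ x a → x * a ≡ x * a + 0ℚ * a
  pad = solve 2 (λ x a → x :* a := x :* a :+ con 0ℚ :* a) refl

linear-Φ : ∀ {T} → IsLinear T → ∀ n (F : ℕ → Series) → T (λ i → Φ n (λ k → F k i)) ≡ Φ n (λ k → T (F k))
linear-Φ T-lin zero    F = refl
linear-Φ {T} T-lin (suc n) F = trans
  (linear-Φ T-lin n _)
  (Φ-linear n .≗-cong λ k → trans (linear-scale T-lin (recip (n ∸ k)) _)
    (cong (recip (n ∸ k) *_) (begin
      T (λ i → s * F (suc n) i - t k * F k i)    ≡⟨ linear-minus T-lin s (F (suc n)) (λ i → t k * F k i) ⟩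
      s * T (F (suc n)) - T (λ i → t k * F k i)  ≡⟨ cong (λ z → s * T (F (suc n)) - z) (linear-scale T-lin
          (t k) (F k)) ⟩
      s * T (F (suc n)) - t k * T (F k)          ∎)))
  where
  s = ι (3 ℕ.+ n ℕ.+ n)
  t : ℕ → ℚ
  t k = ι (2 ℕ.+ n ℕ.+ k)
open IsLinear

recip-inverse-+ : ∀ m n → recip (m ℕ.+ n) * (1ℚ + ι m + ι n) ≡ 1ℚ
recip-inverse-+ m n = begin
  recip (m ℕ.+ n) * (1ℚ + ι m + ι n)      ≡⟨ cong (recip (m ℕ.+ n) *_) (+-assoc 1ℚ (ι m) (ι n)) ⟩
  recip (m ℕ.+ n) * (1ℚ + (ι m + ι n))    ≡⟨ cong (λ x → recip (m ℕ.+ n) * (1ℚ + x)) (ι-+ m n) ⟨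
  recip (m ℕ.+ n) * (1ℚ + ι (m ℕ.+ n))    ≡⟨ cong (recip (m ℕ.+ n) *_) (ι-suc (m ℕ.+ n)) ⟨
  recip (m ℕ.+ n) * ι (suc (m ℕ.+ n))     ≡⟨ recip-inverse (m ℕ.+ n) ⟩
  1ℚ                                      ∎

-- Replaces clearing of denominators: factors known to be 1 are inserted until both sides agree as
-- polynomials, the ring solver regroups them, and the remaining unit factors are dropped.
*-unitʳ : ∀ {x : ℚ} z → x ≡ 1ℚ → z * x ≡ z
*-unitʳ z refl = *-identityʳ z

-- Writing n = k + p removes truncated subtraction and makes the coefficients polynomials in `ι k`
-- and `ι p`.
Φ-weight : ∀ k p → let n = k ℕ.+ p in ∀ x y →
  recip (n ∸ k) * (ι (3 ℕ.+ n ℕ.+ n) * x - ι (2 ℕ.+ n ℕ.+ k) * y) ≡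
  recip p * ((ι 3 + ι 2 * (ι k + ι p)) * x - (ι 2 + (ι k + ι p) + ι k) * y)
Φ-weight k p x y = cong₂ _*_ (cong recip (ℕ.m+n∸m≡n k p)) (cong₂ (λ s t → s * x - t * y) s≡ t≡)
  where
  n = k ℕ.+ p
  s≡ : ι (3 ℕ.+ n ℕ.+ n) ≡ ι 3 + ι 2 * (ι k + ι p)
  s≡ = trans (trans (ι-+ (3 ℕ.+ n) n) (cong₂ _+_ (ι-+ 3 n) refl)) (trans (solve 1 (λ n → con (ι 3) :+ n :+ n
      := con (ι 3) :+ con (ι 2) :* n) refl (ι n))
    (cong (λ n → ι 3 + ι 2 * n) (ι-+ k p)))
  t≡ : ι (2 ℕ.+ n ℕ.+ k) ≡ ι 2 + (ι k + ι p) + ι k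
  t≡ = trans (ι-+ (2 ℕ.+ n) k) (cong (_+ ι k) (trans (ι-+ 2 n) (cong (λ n → ι 2 + n) (ι-+ k p))))

-- Residues at t = − k and t = − n − 1 of (t − n − 2) / ((t + k) (t + n + 1)), where n = k + p and t = m + 1.

partial-fraction : ∀ a b c K P M → a * (1ℚ + P) ≡ 1ℚ → b * (ι 2 + K + P + M) ≡ 1ℚ → c * (1ℚ + K + M) ≡ 1ℚ →
  a * ((ι 3 + ι 2 * (K + P)) * b - (ι 2 + (K + P) + K) * c) ≡ (M - (K + P) - 1ℚ) * b * c
partial-fraction a b c K P M ea eb ec = begin
  a * ((ι 3 + ι 2 * (K + P)) * b - (ι 2 + (K + P) + K) * c)
    ≡⟨ cong₂ (λ x y → a * ((ι 3 + ι 2 * (K + P)) * x - (ι 2 + (K + P) + K) * y)) (*-unitʳ b ec) (*-unitʳ c eb) ⟨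
  a * ((ι 3 + ι 2 * (K + P)) * (b * (c * (1ℚ + K + M))) - (ι 2 + (K + P) + K) * (c * (b * (ι 2 + K + P + M))))
    ≡⟨ solve 6 (λ a b c K P M →
         a :* ((con (ι 3) :+ con (ι 2) :* (K :+ P)) :* (b :* (c :* (con 1ℚ :+ K :+ M)))
           :- (con (ι 2) :+ (K :+ P) :+ K) :* (c :* (b :* (con (ι 2) :+ K :+ P :+ M))))
         := (M :- (K :+ P) :- con 1ℚ) :* b :* c :* (a :* (con 1ℚ :+ P))) refl a b c K P M ⟩
  (M - (K + P) - 1ℚ) * b * c * (a * (1ℚ + P))
    ≡⟨ *-unitʳ _ ea ⟩
  (M - (K + P) - 1ℚ) * b * c ∎

-- Minus the derivative of partial-fraction in t, at t = 1.

partial-fraction² : ∀ a b c K P → a * (1ℚ + P) ≡ 1ℚ → b * (ι 2 + K + P) ≡ 1ℚ → c * (1ℚ + K) ≡ 1ℚ →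
  a * ((ι 3 + ι 2 * (K + P)) * (b * b) - (ι 2 + (K + P) + K) * (c * c)) ≡
  - ((1ℚ + (K + P)) * b) * (c * c) + - ((ι 3 + ι 2 * (K + P)) * (b * b)) * c
partial-fraction² a b c K P ea eb ec = begin
  a * ((ι 3 + ι 2 * (K + P)) * (b * b) - (ι 2 + (K + P) + K) * (c * c))
    ≡⟨ cong₂ (λ x y → a * ((ι 3 + ι 2 * (K + P)) * x - (ι 2 + (K + P) + K) * y))
         (trans (*-unitʳ _ ec) (*-unitʳ _ ec)) (trans (*-unitʳ _ eb) (*-unitʳ _ eb)) ⟨
  a * ((ι 3 + ι 2 * (K + P)) * (b * b * (c * (1ℚ + K)) * (c * (1ℚ + K)))
     - (ι 2 + (K + P) + K) * (c * c * (b * (ι 2 + K + P)) * (b * (ι 2 + K + P))))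
    ≡⟨ solve 5 (λ a b c K P →
         a :* ((con (ι 3) :+ con (ι 2) :* (K :+ P)) :* (b :* b :* (c :* (con 1ℚ :+ K)) :* (c :* (con 1ℚ :+ K)))
           :- (con (ι 2) :+ (K :+ P) :+ K) :* (c :* c :* (b :* (con (ι 2) :+ K :+ P)) :* (b :* (con
               (ι 2) :+ K :+ P))))
         := (:- ((con 1ℚ :+ (K :+ P)) :* b) :* (c :* c) :* (b :* (con (ι 2) :+ K :+ P))
           :+ :- ((con (ι 3) :+ con (ι 2) :* (K :+ P)) :* (b :* b)) :* c :* (c :* (con 1ℚ :+ K))) :* (a :*
               (con 1ℚ :+ P)))
         refl a b c K P ⟩
  (- ((1ℚ + (K + P)) * b) * (c * c) * (b * (ι 2 + K + P))
     + - ((ι 3 + ι 2 * (K + P)) * (b * b)) * c * (c * (1ℚ + K))) * (a * (1ℚ + P))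
    ≡⟨ *-unitʳ _ ea ⟩
  - ((1ℚ + (K + P)) * b) * (c * c) * (b * (ι 2 + K + P))
     + - ((ι 3 + ι 2 * (K + P)) * (b * b)) * c * (c * (1ℚ + K))
    ≡⟨ cong₂ _+_ (*-unitʳ (- ((1ℚ + (K + P)) * b) * (c * c)) eb) (*-unitʳ (- ((ι 3 + ι 2 * (K + P)) *
        (b * b)) * c) ec) ⟩
  - ((1ℚ + (K + P)) * b) * (c * c) + - ((ι 3 + ι 2 * (K + P)) * (b * b)) * c ∎

-- ρ n m = (t − 2) ⋯ (t − n − 1) / (t (t + 1) ⋯ (t + n)) at t = m + 1

ρ : ℕ → ℕ → ℚ
ρ zero    m = recip m
ρ (suc n) m = (ι m - ι n - 1ℚ) * recip (suc n ℕ.+ m) * ρ n m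

recip-inverse₁ : ∀ p → recip p * (1ℚ + ι p) ≡ 1ℚ
recip-inverse₁ p = trans (cong (recip p *_) (sym (ι-suc p))) (recip-inverse p)

recip-inverse₂ : ∀ k p m → recip (suc (k ℕ.+ p) ℕ.+ m) * (ι 2 + ι k + ι p + ι m) ≡ 1ℚ
recip-inverse₂ k p m = trans (cong (recip (suc (k ℕ.+ p) ℕ.+ m) *_) (begin
  ι 2 + ι k + ι p + ι m                 ≡⟨ solve 3 (λ k p m → con (ι 2) :+ k :+ p :+ m
      := con 1ℚ :+ (con 1ℚ :+ (k :+ p)) :+ m) refl (ι k) (ι p) (ι m) ⟩
  1ℚ + (1ℚ + (ι k + ι p)) + ι m         ≡⟨ cong (λ x → 1ℚ + (1ℚ + x) + ι m) (ι-+ k p) ⟨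
  1ℚ + (1ℚ + ι (k ℕ.+ p)) + ι m         ≡⟨ cong (λ x → 1ℚ + x + ι m) (ι-suc (k ℕ.+ p)) ⟨
  1ℚ + ι (suc (k ℕ.+ p)) + ι m          ∎)) (recip-inverse-+ (suc (k ℕ.+ p)) m)

-- At t = m + 1 the step of `Φ` multiplies 1 / (t + k) by (t - n - 2) / (t + n + 1), which is free
-- of `k` and comes out by linearity.
Φ-pole : ∀ n m → Φ n (λ k → recip (k ℕ.+ m)) ≡ ρ n m
Φ-pole zero    m = refl
Φ-pole (suc n) m = begin
  Φ (suc n) (λ k → recip (k ℕ.+ m))         ≡⟨ Φ-cong n step ⟩
  Φ n (λ k → x * recip (k ℕ.+ m))           ≡⟨ linear-scale (Φ-linear n) x (λ k → recip (k ℕ.+ m)) ⟩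
  x * Φ n (λ k → recip (k ℕ.+ m))           ≡⟨ cong (x *_) (Φ-pole n m) ⟩
  ρ (suc n) m                               ∎
  where
  x = (ι m - ι n - 1ℚ) * recip (suc n ℕ.+ m)
  step : ∀ k → k ℕ.≤ n →
    recip (n ∸ k) * (ι (3 ℕ.+ n ℕ.+ n) * recip (suc n ℕ.+ m) - ι (2 ℕ.+ n ℕ.+ k) * recip
        (k ℕ.+ m)) ≡ x * recip (k ℕ.+ m)
  step k k≤n with p , refl ← ℕ.m≤n⇒∃[o]m+o≡n k≤n = begin
    _ ≡⟨ Φ-weight k p _ _ ⟩
    _ ≡⟨ partial-fraction (recip p) (recip (suc n ℕ.+ m)) (recip (k ℕ.+ m)) (ι k) (ι p) (ι m)
           (recip-inverse₁ p) (recip-inverse₂ k p m) (recip-inverse-+ k m) ⟩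
    (ι m - (ι k + ι p) - 1ℚ) * recip (suc n ℕ.+ m) * recip (k ℕ.+ m)
      ≡⟨ cong (λ y → (ι m - y - 1ℚ) * recip (suc n ℕ.+ m) * recip (k ℕ.+ m)) (ι-+ k p) ⟨
    x * recip (k ℕ.+ m) ∎

ρ-zero : ∀ n → ρ n 0 ≡ (- 1ℚ) ^ n * recip n
ρ-zero zero    = refl
ρ-zero (suc n) = begin
  (0ℚ - ι n - 1ℚ) * recip (suc n ℕ.+ 0) * ρ n 0
    ≡⟨ cong₂ (λ k x → (0ℚ - ι n - 1ℚ) * recip k * x) (ℕ.+-identityʳ (suc n)) (ρ-zero n) ⟩
  (0ℚ - ι n - 1ℚ) * recip (suc n) * ((- 1ℚ) ^ n * recip n)
    ≡⟨ solve 4 (λ n b s r → (con 0ℚ :- n :- con 1ℚ) :* b :* (s :* r)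
        := :- con 1ℚ :* s :* b :* (r :* (con 1ℚ :+ n)))
         refl (ι n) (recip (suc n)) ((- 1ℚ) ^ n) (recip n) ⟩
  - 1ℚ * (- 1ℚ) ^ n * recip (suc n) * (recip n * (1ℚ + ι n))
    ≡⟨ *-unitʳ _ (recip-inverse₁ n) ⟩
  (- 1ℚ) ^ suc n * recip (suc n) ∎

-- The argument is t = j + 2, one of the zeros 2, ..., n + 1; the factor introduced in passing from
-- `ρ j` to `ρ (suc j)` vanishes there.
ρ-root : ∀ n j → j ℕ.< n → ρ n (suc j) ≡ 0ℚ
ρ-root (suc n) j (ℕ.s≤s j≤n) with ℕ.m≤n⇒m<n∨m≡n j≤n
... | inj₁ j<n = trans (cong (x *_) (ρ-root n j j<n)) (*-zeroʳ x)
  where x = (ι (suc j) - ι n - 1ℚ) * recip (suc n ℕ.+ suc j)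
... | inj₂ refl = trans (cong (λ x → (x - ι j - 1ℚ) * recip (suc n ℕ.+ suc j) * ρ n (suc j)) (ι-suc j))
  (solve 3 (λ j r x → (con 1ℚ :+ j :- j :- con 1ℚ) :* r :* x
      := con 0ℚ) refl (ι j) (recip (suc n ℕ.+ suc j)) (ρ n (suc j)))

ι! : ∀ n → ι (suc n !) ≡ (1ℚ + ι n) * ι (n !)
ι! n = trans (ι-* (suc n) (n !)) (cong (_* ι (n !)) (ι-suc n))

-- The numerator is (r + m)! / r! and the denominator (r + 2m + 2)! / (r + m + 1)!. Only r = 0 is
-- wanted, but `ρ` recurses on m with t fixed, which turns r into r + 1.
ρ-factorial : ∀ m r → ρ m (suc (r ℕ.+ m)) * (ι (r !) * ι ((2 ℕ.+ r ℕ.+ m ℕ.+ m) !))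
    ≡ ι ((r ℕ.+ m) !) * ι (suc (r ℕ.+ m) !)
ρ-factorial zero r = begin
  recip (suc (r ℕ.+ 0)) * (ι (r !) * ι ((2 ℕ.+ r ℕ.+ 0 ℕ.+ 0) !))
    ≡⟨ cong₂ (λ k l → recip (suc k) * (ι (r !) * ι ((2 ℕ.+ l) !))) (ℕ.+-identityʳ r)
        (trans (ℕ.+-identityʳ (r ℕ.+ 0)) (ℕ.+-identityʳ r)) ⟩
  recip (suc r) * (ι (r !) * ι ((2 ℕ.+ r) !))
    ≡⟨ cong (λ x → recip (suc r) * (ι (r !) * x)) (ι! (suc r)) ⟩
  recip (suc r) * (ι (r !) * ((1ℚ + ι (suc r)) * ι (suc r !)))
    ≡⟨ solve 4 (λ a x b y → a :* (x :* (b :* y))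
        := x :* y :* (a :* b)) refl (recip (suc r)) (ι (r !)) (1ℚ + ι (suc r)) (ι (suc r !)) ⟩
  ι (r !) * ι (suc r !) * (recip (suc r) * (1ℚ + ι (suc r)))
    ≡⟨ *-unitʳ _ (recip-inverse₁ (suc r)) ⟩
  ι (r !) * ι (suc r !)
    ≡⟨ cong (λ k → ι (k !) * ι (suc k !)) (ℕ.+-identityʳ r) ⟨
  ι ((r ℕ.+ 0) !) * ι (suc (r ℕ.+ 0) !) ∎
ρ-factorial (suc m) r = begin
  (ι t - ι m - 1ℚ) * recip (suc m ℕ.+ t) * ρ m t * (ι (r !) * ι ((2 ℕ.+ r ℕ.+ suc m ℕ.+ suc m) !))
    ≡⟨ cong₂ (λ k l → (ι t - ι m - 1ℚ) * recip k * ρ m t * (ι (r !) * ι (suc l !))) e₁ e₂ ⟩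
  (ι t - ι m - 1ℚ) * recip q * ρ m t * (ι (r !) * ι (suc q !))
    ≡⟨ cong₂ (λ x y → x * recip q * ρ m t * (ι (r !) * y)) e₃ (ι! q) ⟩
  (1ℚ + ι r) * recip q * ρ m t * (ι (r !) * ((1ℚ + ι q) * ι (q !)))
    ≡⟨ solve 6 (λ r b x f q g → (con 1ℚ :+ r) :* b :* x :* (f :* ((con 1ℚ :+ q) :* g))
        := x :* ((con 1ℚ :+ r) :* f :* g) :* (b :* (con 1ℚ :+ q)))
         refl (ι r) (recip q) (ρ m t) (ι (r !)) (ι q) (ι (q !)) ⟩
  ρ m t * ((1ℚ + ι r) * ι (r !) * ι (q !)) * (recip q * (1ℚ + ι q))
    ≡⟨ *-unitʳ _ (recip-inverse₁ q) ⟩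
  ρ m t * ((1ℚ + ι r) * ι (r !) * ι (q !))
    ≡⟨ cong₂ (λ k x → ρ m (suc k) * (x * ι (q !))) (ℕ.+-suc r m) (sym (ι! r)) ⟩
  ρ m (suc (suc r ℕ.+ m)) * (ι (suc r !) * ι (q !))
    ≡⟨ ρ-factorial m (suc r) ⟩
  ι ((suc r ℕ.+ m) !) * ι (suc (suc r ℕ.+ m) !)
    ≡⟨ cong (λ k → ι (k !) * ι (suc k !)) (ℕ.+-suc r m) ⟨
  ι ((r ℕ.+ suc m) !) * ι (suc (r ℕ.+ suc m) !) ∎
  where
  t = suc (r ℕ.+ suc m)
  q = 3 ℕ.+ r ℕ.+ m ℕ.+ m
  e₁ : suc m ℕ.+ t ≡ q
  e₁ = solveℕ 2 (λ m r → conℕ 1 ⊕ m ⊕ (conℕ 1 ⊕ (r ⊕ (conℕ 1 ⊕ m))) ⊜ conℕ 3 ⊕ r ⊕ m ⊕ m) refl m r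
  e₂ : suc (r ℕ.+ suc m ℕ.+ suc m) ≡ q
  e₂ = solveℕ 2 (λ m r → conℕ 1 ⊕ (r ⊕ (conℕ 1 ⊕ m) ⊕ (conℕ 1 ⊕ m)) ⊜ conℕ 3 ⊕ r ⊕ m ⊕ m) refl m r
  e₃ : ι t - ι m - 1ℚ ≡ 1ℚ + ι r
  e₃ = begin
    ι t - ι m - 1ℚ                  ≡⟨ cong (λ k → ι (suc k) - ι m - 1ℚ) (ℕ.+-suc r m) ⟩
    ι (2 ℕ.+ (r ℕ.+ m)) - ι m - 1ℚ  ≡⟨ cong (λ x → x - ι m - 1ℚ) (trans (ι-+ 2 (r ℕ.+ m))
        (cong (λ x → ι 2 + x) (ι-+ r m))) ⟩
    ι 2 + (ι r + ι m) - ι m - 1ℚ    ≡⟨ solve 2 (λ r m → con (ι 2) :+ (r :+ m) :- m :- con 1ℚ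
        := con 1ℚ :+ r) refl (ι r) (ι m) ⟩
    1ℚ + ι r                        ∎

harmonic-suc : ∀ n → harmonic (suc n) ≡ harmonic n + recip n
harmonic-suc n = trans (sum-init-last {n} (λ j → recip (toℕ j)))
  (cong₂ _+_ (sum-cong-≗ {n} λ j → cong recip (toℕ-inject₁ j)) (cong recip (toℕ-fromℕ n)))

-- 1 / (k + 1)² is minus the derivative of 1 / (t + k) at t = 1, so the sum is -R′(1) for the
-- rational function R. There R is (-1)ⁿ / (n + 1), the zeros 2, ..., n + 1 contribute -𝓗ₙ to R′/R,
-- and the poles 0, ..., -n contribute -𝓗ₙ₊₁.
Φ-double-pole : ∀ n → Φ n (λ k → recip k * recip k) ≡ (- 1ℚ) ^ n * recip n * (harmonic n + harmonic (suc n))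
Φ-double-pole zero    = refl
Φ-double-pole (suc n) = begin
  Φ (suc n) (λ k → recip k * recip k)
    ≡⟨ Φ-cong n step ⟩
  -- Product rule at t = 1 for the new factor (t - n - 2) / (t + n + 1): its value is -(n + 1) / (n
  -- + 2) and its derivative (2n + 3) / (n + 2)².
  Φ n (λ k → - (u * b) * (recip k * recip k) + - (w * (b * b)) * recip k)
    ≡⟨ Φ-linear n .linear (- (u * b)) (- (w * (b * b))) (λ k → recip k * recip k) recip ⟩
  - (u * b) * Φ n (λ k → recip k * recip k) + - (w * (b * b)) * Φ n recip
    ≡⟨ cong₂ (λ x y → - (u * b) * x + - (w * (b * b)) * y) (Φ-double-pole n)
         (trans (Φ-cong n (λ k _ → cong recip (sym (ℕ.+-identityʳ k)))) (trans (Φ-pole n 0) (ρ-zero n))) ⟩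
  - (u * b) * (s * r * (h + harmonic (suc n))) + - (w * (b * b)) * (s * r)
    ≡⟨ cong (λ x → - (u * b) * (s * r * (h + x)) + - (w * (b * b)) * (s * r)) (harmonic-suc n) ⟩
  - (u * b) * (s * r * (h + (h + r))) + - (w * (b * b)) * (s * r)
    ≡⟨ algebra (ι n) b r s h (recip-inverse₁ n) (trans (cong (b *_) (trans (solve 1 (λ n → con (ι 2) :+ n
        := con 1ℚ :+ (con 1ℚ :+ n)) refl (ι n))
        (cong (λ x → 1ℚ + x) (sym (ι-suc n))))) (recip-inverse₁ (suc n))) ⟩
  - 1ℚ * s * b * (h + r + (h + r + b))
    ≡⟨ cong₂ (λ x y → - 1ℚ * s * b * (x + y)) (harmonic-suc n) (trans (harmonic-suc (suc n))
        (cong (_+ b) (harmonic-suc n))) ⟨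
  (- 1ℚ) ^ suc n * b * (harmonic (suc n) + harmonic (suc (suc n))) ∎
  where
  b = recip (suc n)
  r = recip n
  s = (- 1ℚ) ^ n
  h = harmonic n
  u = 1ℚ + ι n
  w = ι 3 + ι 2 * ι n
  step : ∀ k → k ℕ.≤ n →
    recip (n ∸ k) * (ι (3 ℕ.+ n ℕ.+ n) * (b * b) - ι (2 ℕ.+ n ℕ.+ k) * (recip k * recip k)) ≡
    - (u * b) * (recip k * recip k) + - (w * (b * b)) * recip k
  step k k≤n with p , refl ← ℕ.m≤n⇒∃[o]m+o≡n k≤n = begin
    _ ≡⟨ Φ-weight k p _ _ ⟩
    _ ≡⟨ partial-fraction² (recip p) b (recip k) (ι k) (ι p) (recip-inverse₁ p)
          (trans (cong₂ (λ i x → recip (suc i) * x) (sym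
              (ℕ.+-identityʳ n)) (sym (+-identityʳ _))) (recip-inverse₂ k p 0))
          (recip-inverse₁ k) ⟩
    - ((1ℚ + (ι k + ι p)) * b) * (recip k * recip k) + - ((ι 3 + ι 2 * (ι k + ι p)) * (b * b)) * recip k
      ≡⟨ cong (λ y → - ((1ℚ + y) * b) * (recip k * recip k) + - ((ι 3 + ι 2 * y) * (b * b)) * recip k)
          (ι-+ k p) ⟨
    - (u * b) * (recip k * recip k) + - (w * (b * b)) * recip k ∎
  algebra : ∀ n b r s h → r * (1ℚ + n) ≡ 1ℚ → b * (ι 2 + n) ≡ 1ℚ →
    - ((1ℚ + n) * b) * (s * r * (h + (h + r))) + - ((ι 3 + ι 2 * n) * (b * b)) * (s * r) ≡
    - 1ℚ * s * b * (h + r + (h + r + b))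
  algebra n b r s h er eb = begin
    - ((1ℚ + n) * b) * (s * r * (h + (h + r))) + - ((ι 3 + ι 2 * n) * (b * b)) * (s * r)
      ≡⟨ solve 5 (λ n b r s h →
           :- ((con 1ℚ :+ n) :* b) :* (s :* r :* (h :+ (h :+ r))) :+ :- ((con (ι 3) :+ con (ι 2) :* n) :*
               (b :* b)) :* (s :* r)
           := :- con 1ℚ :* s :* b :* ((h :+ (h :+ r)) :* (r :* (con 1ℚ :+ n)) :+ (b :* (r :*
               (con 1ℚ :+ n)) :+ r :* (b :* (con (ι 2) :+ n)))))
           refl n b r s h ⟩
    - 1ℚ * s * b * ((h + (h + r)) * (r * (1ℚ + n)) + (b * (r * (1ℚ + n)) + r * (b * (ι 2 + n))))
      ≡⟨ cong (λ x → - 1ℚ * s * b * x) (cong₂ _+_ (*-unitʳ (h + (h + r)) er)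
          (cong₂ _+_ (*-unitʳ b er) (*-unitʳ r eb))) ⟩
    - 1ℚ * s * b * ((h + (h + r)) + (b + r))
      ≡⟨ solve 4 (λ b r s h → :- con 1ℚ :* s :* b :* ((h :+ (h :+ r)) :+ (b :+ r))
          := :- con 1ℚ :* s :* b :* (h :+ r :+ (h :+ r :+ b))) refl b r s h ⟩
    - 1ℚ * s * b * (h + r + (h + r + b)) ∎
open IsLinear

-- The Bernoulli recurrence as a shift z ↦ z + 1

!⁻¹-suc : ∀ n → ι (suc n) * suc n !⁻¹ ≡ n !⁻¹
!⁻¹-suc n = begin
  ι (suc n) * suc n !⁻¹                              ≡⟨ *-unitʳ _ (!*!⁻¹ n) ⟨
  ι (suc n) * suc n !⁻¹ * (ι (n !) * n !⁻¹)          ≡⟨ solve 4 (λ a b c d → a :* b :* (c :* d)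
      := d :* (a :* c :* b)) refl (ι (suc n)) (suc n !⁻¹) (ι (n !)) (n !⁻¹) ⟩
  n !⁻¹ * (ι (suc n) * ι (n !) * suc n !⁻¹)          ≡⟨ cong (λ x → n !⁻¹ * (x * suc n !⁻¹)) (ι-* (suc n)
      (n !)) ⟨
  n !⁻¹ * (ι (suc n !) * suc n !⁻¹)                  ≡⟨ *-unitʳ _ (!*!⁻¹ (suc n)) ⟩
  n !⁻¹                                              ∎

-- If f n = J(zⁿ), then binomial f n = J((z + 1)ⁿ).

binomial : Series → Series
binomial f zero    = f 0
binomial f (suc n) = binomial f n + binomial (shift f) n

binomial-linear : ∀ n → IsLinear (λ f → binomial f n)
binomial-linear zero    .≗-cong e = e 0
binomial-linear (suc n) .≗-cong e = cong₂ _+_ (binomial-linear n .≗-cong e) (binomial-linear n .≗-cong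
    (e ∘ suc))
binomial-linear zero    .linear x y f g = refl
binomial-linear (suc n) .linear x y f g = trans
  (cong₂ _+_ (binomial-linear n .linear x y f g) (binomial-linear n .linear x y (shift f) (shift g)))
  (solve 6 (λ x y a b c d → x :* a :+ y :* b :+ (x :* c :+ y :* d) := x :* (a :+ c) :+ y :* (b :+ d)) refl
    x y (binomial f n) (binomial g n) (binomial (shift f) n) (binomial (shift g) n))

-- The derivative (eᵗ F)′ = eᵗ F + eᵗ F′ in coefficients, since `shift` differentiates an
-- exponential generating function.
exp-⊛-suc : ∀ f n → ι (suc n) * (exp ⊛ egf f) (suc n) ≡ (exp ⊛ egf f) n + (exp ⊛ egf (shift f)) n
exp-⊛-suc f n = begin
  ι (suc n) * sum term
    ≡⟨ *-distribˡ-sum (ι (suc n)) term ⟩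
  sum (λ i → ι (suc n) * term i)
    ≡⟨ sum-cong-≗ split ⟩
  sum (λ i → ι (toℕ i) * term i + ι (suc n ∸ toℕ i) * term i)
    ≡⟨ ∑-distrib-+ (λ i → ι (toℕ i) * term i) (λ i → ι (suc n ∸ toℕ i) * term i) ⟩
  sum (λ i → ι (toℕ i) * term i) + sum (λ i → ι (suc n ∸ toℕ i) * term i)
    ≡⟨ cong₂ _+_ left right ⟩
  (exp ⊛ egf f) n + (exp ⊛ egf (shift f)) n ∎
  where
  term : Fin (2 ℕ.+ n) → ℚ
  term i = exp (toℕ i) * egf f (suc n ∸ toℕ i)
  split : ∀ i → ι (suc n) * term i ≡ ι (toℕ i) * term i + ι (suc n ∸ toℕ i) * term i
  split i = begin
    ι (suc n) * term i                                   ≡⟨ cong (λ k → ι k * term i)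
        (ℕ.m+[n∸m]≡n (toℕ≤pred[n] i)) ⟨
    ι (toℕ i ℕ.+ (suc n ∸ toℕ i)) * term i               ≡⟨ cong (_* term i) (ι-+ (toℕ i) (suc n ∸ toℕ i)) ⟩
    (ι (toℕ i) + ι (suc n ∸ toℕ i)) * term i             ≡⟨ *-distribʳ-+ (term i) (ι (toℕ i)) (ι
        (suc n ∸ toℕ i)) ⟩
    ι (toℕ i) * term i + ι (suc n ∸ toℕ i) * term i      ∎
  left : sum (λ i → ι (toℕ i) * term i) ≡ (exp ⊛ egf f) n
  left = trans (cong₂ _+_ (*-zeroˡ (term zero)) (sum-cong-≗ {suc n} λ j →
    trans (sym (*-assoc (ι (suc (toℕ j))) (exp (suc (toℕ j))) (egf f (n ∸ toℕ j))))
        (cong (_* egf f (n ∸ toℕ j)) (!⁻¹-suc (toℕ j)))))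
    (+-identityˡ _)
  init-term : ∀ (j : Fin (suc n)) →
    ι (suc n ∸ toℕ (inject₁ j)) * term (inject₁ j) ≡ exp (toℕ j) * egf (shift f) (n ∸ toℕ j)
  init-term j = begin
    ι (suc n ∸ toℕ (inject₁ j)) * (exp (toℕ (inject₁ j)) * egf f (suc n ∸ toℕ (inject₁ j)))
      ≡⟨ cong (λ k → ι (suc n ∸ k) * (exp k * egf f (suc n ∸ k))) (toℕ-inject₁ j) ⟩
    ι (suc n ∸ toℕ j) * (exp (toℕ j) * egf f (suc n ∸ toℕ j))
      ≡⟨ cong (λ k → ι k * (exp (toℕ j) * egf f k)) (ℕ.+-∸-assoc 1 (toℕ≤pred[n] j)) ⟩
    ι (suc m) * (exp (toℕ j) * (f (suc m) * suc m !⁻¹))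
      ≡⟨ solve 4 (λ s e f i → s :* (e :* (f :* i))
          := e :* (f :* (s :* i))) refl (ι (suc m)) (exp (toℕ j)) (f (suc m)) (suc m !⁻¹) ⟩
    exp (toℕ j) * (f (suc m) * (ι (suc m) * suc m !⁻¹))
      ≡⟨ cong (λ x → exp (toℕ j) * (f (suc m) * x)) (!⁻¹-suc m) ⟩
    exp (toℕ j) * egf (shift f) m ∎
    where m = n ∸ toℕ j
  last-term : ι (suc n ∸ toℕ (fromℕ (suc n))) * term (fromℕ (suc n)) ≡ 0ℚ
  last-term = trans (cong (λ k → ι k * term (fromℕ (suc n)))
    (trans (cong (suc n ∸_) (toℕ-fromℕ (suc n))) (ℕ.n∸n≡0 (suc n)))) (*-zeroˡ (term (fromℕ (suc n))))
  right : sum (λ i → ι (suc n ∸ toℕ i) * term i) ≡ (exp ⊛ egf (shift f)) n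
  right = begin
    sum (λ i → ι (suc n ∸ toℕ i) * term i)
      ≡⟨ sum-init-last (λ i → ι (suc n ∸ toℕ i) * term i) ⟩
    sum {suc n} (λ j → ι (suc n ∸ toℕ (inject₁ j)) * term (inject₁ j)) + ι (suc n ∸ toℕ (fromℕ
        (suc n))) * term (fromℕ (suc n))
      ≡⟨ cong₂ _+_ (sum-cong-≗ {suc n} init-term) last-term ⟩
    (exp ⊛ egf (shift f)) n + 0ℚ
      ≡⟨ +-identityʳ _ ⟩
    (exp ⊛ egf (shift f)) n ∎

exp-⊛-egf : ∀ f n → (exp ⊛ egf f) n ≡ egf (binomial f) n
exp-⊛-egf f zero    = solve 1 (λ x → con 1ℚ :* (x :* con 1ℚ) :+ con 0ℚ := x :* con 1ℚ) refl (f 0)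
exp-⊛-egf f (suc n) = begin
  (exp ⊛ egf f) (suc n)
    ≡⟨ *-unitʳ _ (trans (*-comm (ι (suc n)) (recip n)) (recip-inverse n)) ⟨
  (exp ⊛ egf f) (suc n) * (ι (suc n) * recip n)
    ≡⟨ solve 3 (λ x i r → x :* (i :* r) := r :* (i :* x)) refl ((exp ⊛ egf f) (suc n)) (ι (suc n)) (recip n) ⟩
  recip n * (ι (suc n) * (exp ⊛ egf f) (suc n))
    ≡⟨ cong (recip n *_) (exp-⊛-suc f n) ⟩
  recip n * ((exp ⊛ egf f) n + (exp ⊛ egf (shift f)) n)
    ≡⟨ cong (recip n *_) (cong₂ _+_ (exp-⊛-egf f n) (exp-⊛-egf (shift f) n)) ⟩
  recip n * (binomial f n * n !⁻¹ + binomial (shift f) n * n !⁻¹)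
    ≡⟨ cong (λ x → recip n * (binomial f n * x + binomial (shift f) n * x)) (!⁻¹-suc n) ⟨
  recip n * (binomial f n * (ι (suc n) * suc n !⁻¹) + binomial (shift f) n * (ι (suc n) * suc n !⁻¹))
    ≡⟨ solve 5 (λ r a i e b → r :* (a :* (i :* e) :+ b :* (i :* e))
        := (a :+ b) :* e :* (r :* i)) refl (recip n) (binomial f n) (ι (suc n)) (suc n !⁻¹) (binomial
        (shift f) n) ⟩
  binomial f (suc n) * suc n !⁻¹ * (recip n * ι (suc n))
    ≡⟨ *-unitʳ _ (recip-inverse n) ⟩
  binomial f (suc n) * suc n !⁻¹ ∎

⊖𝟙-⊛ : ∀ f g n → ((f ⊖ 𝟙) ⊛ g) n ≡ (f ⊛ g) n - g n
⊖𝟙-⊛ f g n = begin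
  (f 0 - 1ℚ) * g n + sum {n} (λ i → (f (suc (toℕ i)) - 0ℚ) * g (n ∸ suc (toℕ i)))
    ≡⟨ cong (λ s → (f 0 - 1ℚ) * g n + s) (sum-cong-≗ {n} λ i → cong (_* g (n ∸ suc (toℕ i))) (+-identityʳ (f
        (suc (toℕ i))))) ⟩
  (f 0 - 1ℚ) * g n + s
    ≡⟨ solve 3 (λ f g s → (f :- con 1ℚ) :* g :+ s := f :* g :+ s :- g) refl (f 0) (g n) s ⟩
  (f ⊛ g) n - g n ∎
  where
  s = sum {n} (λ i → f (suc (toℕ i)) * g (n ∸ suc (toℕ i)))

n!*𝕥 : ∀ n → ι (n !) * 𝕥 n ≡ 𝕥 n
n!*𝕥 zero          = refl
n!*𝕥 (suc zero)    = refl
n!*𝕥 (suc (suc n)) = *-zeroʳ (ι ((2 ℕ.+ n) !))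

-- This is eᵗ F = t + F for F = t / (eᵗ - 1). The factors `1ℚ` give it the shape that `linear`
-- expects.
binomial-B : ∀ n → binomial B n ≡ 1ℚ * 𝕥 n + 1ℚ * B n
binomial-B n = begin
  binomial B n
    ≡⟨ *-unitʳ _ (!*!⁻¹ n) ⟨
  binomial B n * (ι (n !) * n !⁻¹)
    ≡⟨ solve 3 (λ x f i → x :* (f :* i) := f :* (x :* i)) refl (binomial B n) (ι (n !)) (n !⁻¹) ⟩
  ι (n !) * egf (binomial B) n
    ≡⟨ cong (ι (n !) *_) (exp-⊛-egf B n) ⟨
  ι (n !) * (exp ⊛ egf B) n
    ≡⟨ solve 3 (λ f x e → f :* x := f :* (x :- e) :+ f :* e) refl (ι (n !)) ((exp ⊛ egf B) n) (egf B n) ⟩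
  ι (n !) * ((exp ⊛ egf B) n - egf B n) + ι (n !) * (B n * n !⁻¹)
    ≡⟨ cong₂ (λ x y → ι (n !) * x + y) (trans (sym (⊖𝟙-⊛ exp (egf B) n)) (B-generatingFunction n))
         (solve 3 (λ f b i → f :* (b :* i) := b :* (f :* i)) refl (ι (n !)) (B n) (n !⁻¹)) ⟩
  ι (n !) * 𝕥 n + B n * (ι (n !) * n !⁻¹)
    ≡⟨ cong₂ _+_ (n!*𝕥 n) (*-unitʳ (B n) (!*!⁻¹ n)) ⟩
  𝕥 n + B n
    ≡⟨ cong₂ _+_ (*-identityˡ (𝕥 n)) (*-identityˡ (B n)) ⟨
  1ℚ * 𝕥 n + 1ℚ * B n ∎

-- f ↦ t f on exponential generating functions; raise B n is n Bₙ₋₁.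

raise : Series → Series
raise f zero    = 0ℚ
raise f (suc n) = ι (suc n) * f n

raise-linear : ∀ n → IsLinear (λ f → raise f n)
raise-linear zero    .≗-cong e = refl
raise-linear (suc n) .≗-cong e = cong (ι (suc n) *_) (e n)
raise-linear zero    .linear x y f g = solve 2 (λ x y → con 0ℚ := x :* con 0ℚ :+ y :* con 0ℚ) refl x y
raise-linear (suc n) .linear x y f g =
  solve 5 (λ s x y a b → s :* (x :* a :+ y :* b)
      := x :* (s :* a) :+ y :* (s :* b)) refl (ι (suc n)) x y (f n) (g n)

shift-raise : ∀ f n → raise f (suc n) ≡ 1ℚ * raise (shift f) n + 1ℚ * f n
shift-raise f zero    = solve 1 (λ x → con 1ℚ :* x := con 1ℚ :* con 0ℚ :+ con 1ℚ :* x) refl (f 0)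
shift-raise f (suc n) = trans (cong (_* f (suc n)) (ι-suc (suc n)))
  (solve 2 (λ i x → (con 1ℚ :+ i) :* x := con 1ℚ :* (i :* x) :+ con 1ℚ :* x) refl (ι (suc n)) (f (suc n)))

-- On generating functions these are multiplication by eᵗ and by t, which commute.
binomial-raise : ∀ f n → binomial (raise f) n ≡ raise (binomial f) n
binomial-raise f zero    = refl
binomial-raise f (suc n) = begin
  binomial (raise f) n + binomial (shift (raise f)) n
    ≡⟨ cong₂ _+_ (binomial-raise f n)
        (trans (binomial-linear n .≗-cong (shift-raise f)) (binomial-linear n .linear 1ℚ 1ℚ (raise
        (shift f)) f)) ⟩
  raise (binomial f) n + (1ℚ * binomial (raise (shift f)) n + 1ℚ * binomial f n)
    ≡⟨ cong (λ x → raise (binomial f) n + (1ℚ * x + 1ℚ * binomial f n)) (binomial-raise (shift f) n) ⟩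
  raise (binomial f) n + (1ℚ * raise (binomial (shift f)) n + 1ℚ * binomial f n)
    ≡⟨ pascal n ⟩
  ι (suc n) * binomial f n ∎
  where
  pascal : ∀ n → raise (binomial f) n + (1ℚ * raise (binomial (shift f)) n + 1ℚ * binomial f n)
      ≡ ι (suc n) * binomial f n
  pascal zero    = solve 1 (λ x → con 0ℚ :+ (con 1ℚ :* con 0ℚ :+ con 1ℚ :* x) := con 1ℚ :* x) refl (f 0)
  pascal (suc n) = trans
    (solve 3 (λ i x y → i :* x :+ (con 1ℚ :* (i :* y) :+ con 1ℚ :* (x :+ y)) := (con 1ℚ :+ i) :* (x :+ y)) refl
      (ι (suc n)) (binomial f n) (binomial (shift f) n))
    (cong (_* (binomial f n + binomial (shift f) n)) (sym (ι-suc (suc n))))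

-- `raise 𝕥` is 2 at index 2 and 0 elsewhere, the functional g ↦ g″(0).
binomial-raise-B : ∀ n → binomial (raise B) n ≡ 1ℚ * raise 𝕥 n + 1ℚ * raise B n
binomial-raise-B n = begin
  binomial (raise B) n                   ≡⟨ binomial-raise B n ⟩
  raise (binomial B) n                   ≡⟨ raise-linear n .≗-cong binomial-B ⟩
  raise (λ n → 1ℚ * 𝕥 n + 1ℚ * B n) n    ≡⟨ raise-linear n .linear 1ℚ 1ℚ 𝕥 B ⟩
  1ℚ * raise 𝕥 n + 1ℚ * raise B n        ∎

-- Telescoping products and the values L(φₖ)

shift+ : ℚ → Series → Series
shift+ r f i = f (suc i) + r * f i

shift+-cong : ∀ r {f g} → f ≗ g → shift+ r f ≗ shift+ r g
shift+-cong r e i = cong₂ (λ x y → x + r * y) (e (suc i)) (e i)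

-- Replacing z by z + 1 turns the factor z + r into z + (1 + r).
shift+-binomial : ∀ r f → shift+ r (binomial f) ≗ binomial (shift+ (1ℚ + r) f)
shift+-binomial r f i = begin
  binomial f i + binomial (shift f) i + r * binomial f i
    ≡⟨ solve 3 (λ r x y → x :+ y :+ r :* x
        := con 1ℚ :* y :+ (con 1ℚ :+ r) :* x) refl r (binomial f i) (binomial (shift f) i) ⟩
  1ℚ * binomial (shift f) i + (1ℚ + r) * binomial f i
    ≡⟨ binomial-linear i .linear 1ℚ (1ℚ + r) (shift f) f ⟨
  binomial (λ i → 1ℚ * f (suc i) + (1ℚ + r) * f i) i
    ≡⟨ binomial-linear i .≗-cong (λ i → cong (_+ (1ℚ + r) * f i) (*-identityˡ (f (suc i)))) ⟩
  binomial (shift+ (1ℚ + r) f) i ∎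

-- If f i = J(zⁱ), then Ω k f i = J(z (z² − 1²) ⋯ (z² − k²) zⁱ), and shift+ r multiplies by z + r.

Ω : ℕ → Series → Series
Ω zero    f i = f (suc i)
Ω (suc k) f i = Ω k f (2 ℕ.+ i) - ι (suc k) * ι (suc k) * Ω k f i

Ω-linear : ∀ k i → IsLinear (λ f → Ω k f i)
Ω-linear zero    i .≗-cong e = e (suc i)
Ω-linear (suc k) i .≗-cong e =
  cong₂ (λ x y → x - ι (suc k) * ι (suc k) * y) (Ω-linear k (2 ℕ.+ i) .≗-cong e) (Ω-linear k i .≗-cong e)
Ω-linear zero    i .linear x y f g = refl
Ω-linear (suc k) i .linear x y f g = trans
  (cong₂ (λ x y → x - ι (suc k) * ι (suc k) * y) (Ω-linear k (2 ℕ.+ i) .linear x y f g)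
      (Ω-linear k i .linear x y f g))
  (solve 7 (λ s x y a b c d → x :* a :+ y :* b :- s :* (x :* c :+ y :* d)
      := x :* (a :- s :* c) :+ y :* (b :- s :* d)) refl
    (ι (suc k) * ι (suc k)) x y (Ω k f (2 ℕ.+ i)) (Ω k g (2 ℕ.+ i)) (Ω k f i) (Ω k g i))

Ω-suc : ∀ k f → Ω (suc k) f ≗ shift+ (ι (suc k)) (shift+ (- ι (suc k)) (Ω k f))
Ω-suc k f i = solve 4 (λ s x y z → z :- s :* s :* x := (z :+ :- s :* y) :+ s :* (y :+ :- s :* x)) refl
  (ι (suc k)) (Ω k f i) (Ω k f (suc i)) (Ω k f (2 ℕ.+ i))

-- z ↦ z + 1 turns (z − k − 1) (z − k) ⋯ (z + k) into (z − k) ⋯ (z + k) (z + k + 1).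

Ω-binomial : ∀ k f → shift+ (- ι (suc k)) (Ω k (binomial f)) ≗ binomial (shift+ (ι (suc k)) (Ω k f))
Ω-binomial zero f i = begin
  binomial f (suc i) + binomial (shift f) (suc i) + - 1ℚ * binomial f (suc i)
    ≡⟨ solve 3 (λ x y z → x :+ (y :+ z) :+ :- con 1ℚ :* x
        := z :+ con 1ℚ :* y) refl (binomial f (suc i)) (binomial (shift f) i) (binomial (shift (shift f)) i) ⟩
  binomial (shift (shift f)) i + 1ℚ * binomial (shift f) i
    ≡⟨ cong (_+ 1ℚ * binomial (shift f) i) (*-identityˡ (binomial (shift (shift f)) i)) ⟨
  1ℚ * binomial (shift (shift f)) i + 1ℚ * binomial (shift f) i
    ≡⟨ binomial-linear i .linear 1ℚ 1ℚ (shift (shift f)) (shift f) ⟨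
  binomial (λ i → 1ℚ * f (2 ℕ.+ i) + 1ℚ * f (suc i)) i
    ≡⟨ binomial-linear i .≗-cong (λ i → cong (_+ 1ℚ * f (suc i)) (*-identityˡ (f (2 ℕ.+ i)))) ⟩
  binomial (shift+ 1ℚ (shift f)) i ∎
Ω-binomial (suc k) f i = begin
  shift+ (- r) (Ω (suc k) (binomial f)) i
    ≡⟨ shift+-cong (- r) (Ω-suc k (binomial f)) i ⟩
  shift+ (- r) (shift+ s (shift+ (- s) (Ω k (binomial f)))) i
    ≡⟨ shift+-cong (- r) (shift+-cong s (Ω-binomial k f)) i ⟩
  shift+ (- r) (shift+ s (binomial (shift+ s (Ω k f)))) i
    ≡⟨ shift+-cong (- r) (shift+-binomial s (shift+ s (Ω k f))) i ⟩
  shift+ (- r) (binomial (shift+ (1ℚ + s) (shift+ s (Ω k f)))) i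
    ≡⟨ shift+-binomial (- r) (shift+ (1ℚ + s) (shift+ s (Ω k f))) i ⟩
  binomial (shift+ (1ℚ - r) (shift+ (1ℚ + s) (shift+ s (Ω k f)))) i
    ≡⟨ binomial-linear i .≗-cong rearrange ⟩
  binomial (shift+ r (Ω (suc k) f)) i ∎
  where
  r = ι (2 ℕ.+ k)
  s = ι (suc k)
  -- As r = s + 1, the three factors are z - s, z + r and z + s, and the outer two are the new
  -- factor of `Ω (suc k)`.
  rearrange : shift+ (1ℚ - r) (shift+ (1ℚ + s) (shift+ s (Ω k f))) ≗ shift+ r (Ω (suc k) f)
  rearrange i = trans
    (cong (λ r → shift+ (1ℚ - r) (shift+ (1ℚ + s) (shift+ s (Ω k f))) i) (ι-suc (suc k)))
    (trans
    (solve 5 (λ s w x y z →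
        let d₀ = x :+ s :* w
            d₁ = y :+ s :* x
            d₂ = z :+ s :* y
            e₀ = d₁ :+ (con 1ℚ :+ s) :* d₀
            e₁ = d₂ :+ (con 1ℚ :+ s) :* d₁
        in
        e₁ :+ (con 1ℚ :- (con 1ℚ :+ s)) :* e₀ := (z :- s :* s :* x) :+ (con 1ℚ :+ s) :* (y :- s :* s :* w)) refl
      s (Ω k f i) (Ω k f (1 ℕ.+ i)) (Ω k f (2 ℕ.+ i)) (Ω k f (3 ℕ.+ i)))
    (cong (λ r → shift+ r (Ω (suc k) f) i) (sym (ι-suc (suc k)))))

-- The second derivative at 0 of zⁱ⁺¹ (z² - 1²) ⋯ (z² - k²): only i = 1 has a z² term, with
-- coefficient (-1)ᵏ k!².
Ω-raise-𝕥 : ∀ k i → Ω k (raise 𝕥) i ≡ ι 2 * ((- 1ℚ) ^ k * (ι (k !) * ι (k !))) * 𝕥 i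
Ω-raise-𝕥 zero    zero          = refl
Ω-raise-𝕥 zero    (suc zero)    = refl
Ω-raise-𝕥 zero    (suc (suc i)) = *-zeroʳ (ι (3 ℕ.+ i))
Ω-raise-𝕥 (suc k) i = begin
  Ω k (raise 𝕥) (2 ℕ.+ i) - s * s * Ω k (raise 𝕥) i
    ≡⟨ cong₂ (λ x y → x - s * s * y) (Ω-raise-𝕥 k (2 ℕ.+ i)) (Ω-raise-𝕥 k i) ⟩
  ι 2 * (g * (F * F)) * 0ℚ - s * s * (ι 2 * (g * (F * F)) * 𝕥 i)
    ≡⟨ solve 4 (λ g F s t → con (ι 2) :* (g :* (F :* F)) :* con 0ℚ :- s :* s :* (con (ι 2) :* (g :*
        (F :* F)) :* t)
         := con (ι 2) :* ((:- con 1ℚ) :* g :* (s :* F :* (s :* F))) :* t) refl g F s (𝕥 i) ⟩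
  ι 2 * (- 1ℚ * g * (s * F * (s * F))) * 𝕥 i
    ≡⟨ cong (λ x → ι 2 * (- 1ℚ * g * (x * x)) * 𝕥 i) (ι-* (suc k) (k !)) ⟨
  ι 2 * ((- 1ℚ) ^ suc k * (ι (suc k !) * ι (suc k !))) * 𝕥 i ∎
  where
  s = ι (suc k)
  F = ι (k !)
  g = (- 1ℚ) ^ k

-- With P = z (z² - 1²) ⋯ (z² - k²), the shift sends (z - k - 1) P to (z + k + 1) P. The difference
-- is 2 (k + 1) P, so J(P) is the second derivative divided by 2 (k + 1).
Ω-raise-B : ∀ k → Ω k (raise B) 0 ≡ (- 1ℚ) ^ k * (ι (k !) * ι (k !) * recip k)
Ω-raise-B k = begin
  y₀
    ≡⟨ *-unitʳ y₀ (recip-inverse k) ⟨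
  y₀ * (recip k * s)
    ≡⟨ solve 4 (λ y₀ y₁ s r → y₀ :* (r :* s)
        := con (1ℤ / 2) :* r :* (y₁ :+ s :* y₀ :- (y₁ :- s :* y₀))) refl y₀ y₁ s (recip k) ⟩
  (1ℤ / 2) * recip k * (y₁ + s * y₀ - (y₁ - s * y₀))
    ≡⟨ cong (λ x → (1ℤ / 2) * recip k * (x - (y₁ - s * y₀))) (Ω-binomial k (raise B) 0) ⟨
  (1ℤ / 2) * recip k * (Ω k (binomial (raise B)) 1 + - s * Ω k (binomial (raise B)) 0 - (y₁ - s * y₀))
    ≡⟨ cong₂ (λ x y → (1ℤ / 2) * recip k * (x + - s * y - (y₁ - s * y₀))) (eval 1) (eval 0) ⟩
  (1ℤ / 2) * recip k * (1ℚ * (ι 2 * c * 1ℚ) + 1ℚ * y₁ + - s * (1ℚ * (ι 2 * c * 0ℚ) + 1ℚ * y₀) - (y₁ - s * y₀))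
    ≡⟨ solve 6 (λ g F y₀ y₁ s r →
         con (1ℤ / 2) :* r :* (con 1ℚ :* (con (ι 2) :* (g :* (F :* F)) :* con 1ℚ) :+ con 1ℚ :* y₁
           :+ :- s :* (con 1ℚ :* (con (ι 2) :* (g :* (F :* F)) :* con 0ℚ) :+ con 1ℚ :* y₀) :- (y₁ :- s :* y₀))
         := g :* (F :* F :* r)) refl ((- 1ℚ) ^ k) (ι (k !)) y₀ y₁ s (recip k) ⟩
  (- 1ℚ) ^ k * (ι (k !) * ι (k !) * recip k) ∎
  where
  s = ι (suc k)
  c = (- 1ℚ) ^ k * (ι (k !) * ι (k !))
  y₀ = Ω k (raise B) 0
  y₁ = Ω k (raise B) 1
  eval : ∀ i → Ω k (binomial (raise B)) i ≡ 1ℚ * (ι 2 * c * 𝕥 i) + 1ℚ * Ω k (raise B) i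
  eval i = begin
    Ω k (binomial (raise B)) i
      ≡⟨ Ω-linear k i .≗-cong binomial-raise-B ⟩
    Ω k (λ n → 1ℚ * raise 𝕥 n + 1ℚ * raise B n) i
      ≡⟨ Ω-linear k i .linear 1ℚ 1ℚ (raise 𝕥) (raise B) ⟩
    1ℚ * Ω k (raise 𝕥) i + 1ℚ * Ω k (raise B) i
      ≡⟨ cong (λ x → 1ℚ * x + 1ℚ * Ω k (raise B) i) (Ω-raise-𝕥 k i) ⟩
    1ℚ * (ι 2 * c * 𝕥 i) + 1ℚ * Ω k (raise B) i ∎

-- The functional L and its Gram matrix

moment : Series
moment k = (+ (2 ℕ.* k ℕ.+ 1) / 1) * B (2 ℕ.* k)

-- Substitution x = z², with one sign for each factor j² - z².
φ-Ω : ∀ k i → φ k moment i ≡ (- 1ℚ) ^ k * Ω k (raise B) (2 ℕ.* i)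
φ-Ω zero    i = trans (cong (λ k → ι k * B (2 ℕ.* i)) (ℕ.+-comm (2 ℕ.* i) 1)) (sym (*-identityˡ _))
φ-Ω (suc k) i = begin
  s * s * φ k moment i - φ k moment (suc i)
    ≡⟨ cong₂ (λ x y → s * s * x - y) (φ-Ω k i) (trans (φ-Ω k (suc i))
        (cong (λ j → g * Ω k (raise B) j) (ℕ.*-suc 2 i))) ⟩
  s * s * (g * Ω k (raise B) (2 ℕ.* i)) - g * Ω k (raise B) (2 ℕ.+ 2 ℕ.* i)
    ≡⟨ solve 4 (λ s g x y → s :* s :* (g :* x) :- g :* y := :- con 1ℚ :* g :* (y :- s :* s :* x)) refl
         s g (Ω k (raise B) (2 ℕ.* i)) (Ω k (raise B) (2 ℕ.+ 2 ℕ.* i)) ⟩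
  - 1ℚ * g * Ω (suc k) (raise B) (2 ℕ.* i) ∎
  where
  s = ι (suc k)
  g = (- 1ℚ) ^ k

sign² : ∀ k → (- 1ℚ) ^ k * (- 1ℚ) ^ k ≡ 1ℚ
sign² zero    = refl
sign² (suc k) = trans (solve 1 (λ g → :- con 1ℚ :* g :* (:- con 1ℚ :* g) := g :* g) refl ((- 1ℚ) ^ k)) (sign² k)

φ-moment : ∀ k → φ k moment 0 ≡ ι (k !) * ι (k !) * recip k
φ-moment k = begin
  φ k moment 0                              ≡⟨ φ-Ω k 0 ⟩
  g * Ω k (raise B) 0                       ≡⟨ cong (g *_) (Ω-raise-B k) ⟩
  g * (g * x)                               ≡⟨ solve 2 (λ g x → g :* (g :* x) := x :* (g :* g)) refl g x ⟩
  x * (g * g)                               ≡⟨ *-unitʳ x (sign² k) ⟩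
  x                                         ∎
  where
  g = (- 1ℚ) ^ k
  x = ι (k !) * ι (k !) * recip k
open IsLinear

n!*[1+n]!⁻¹ : ∀ n → ι (n !) * suc n !⁻¹ ≡ recip n
n!*[1+n]!⁻¹ n = begin
  F * w                               ≡⟨ *-unitʳ (F * w) (recip-inverse n) ⟨
  F * w * (recip n * ι (suc n))       ≡⟨ solve 4 (λ F w r i → F :* w :* (r :* i)
      := r :* (F :* (i :* w))) refl F w (recip n) (ι (suc n)) ⟩
  recip n * (F * (ι (suc n) * w))     ≡⟨ cong (λ x → recip n * (F * x)) (!⁻¹-suc n) ⟩
  recip n * (F * n !⁻¹)               ≡⟨ *-unitʳ (recip n) (!*!⁻¹ n) ⟩
  recip n                             ∎
  where
  F = ι (n !)
  w = suc n !⁻¹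

-- By induction on j, from φₖ₊₁ φⱼ − φₖ φⱼ₊₁ = ((k + 1)² − (j + 1)²) φₖ φⱼ.

gram : ∀ j k → φ j (shift (φ k moment)) 0 ≡
       ι (suc k !) * ι (k !) * (ι (suc j !) * ι (j !)) * recip (k ℕ.+ suc j)
gram zero k = begin
  φ k moment 1
    -- x φₖ = (k + 1)² φₖ - φₖ₊₁ reduces the case j = 0 to `φ-moment`.
    ≡⟨ solve 2 (λ x y → y := x :- (x :- y)) refl (s * s * φ k moment 0) (φ k moment 1) ⟩
  s * s * φ k moment 0 - φ (suc k) moment 0
    ≡⟨ cong₂ (λ x y → s * s * x - y) (φ-moment k) (φ-moment (suc k)) ⟩
  s * s * (F * F * r) - ι (suc k !) * ι (suc k !) * r′
    ≡⟨ cong (λ x → s * s * (F * F * r) - x * x * r′) (ι-* (suc k) (k !)) ⟩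
  s * s * (F * F * r) - s * F * (s * F) * r′
    ≡⟨ solve 4 (λ s F r r′ → s :* s :* (F :* F :* r) :- s :* F :* (s :* F) :* r′
         := s :* F :* F :* (r :* s) :- s :* F :* (s :* F) :* r′) refl s F r r′ ⟩
  s * F * F * (r * s) - s * F * (s * F) * r′
    ≡⟨ cong (λ x → s * F * F * x - s * F * (s * F) * r′)
        (trans (recip-inverse k) (sym (recip-inverse₁ (suc k)))) ⟩
  s * F * F * (r′ * (1ℚ + s)) - s * F * (s * F) * r′
    ≡⟨ solve 3 (λ s F r′ → s :* F :* F :* (r′ :* (con 1ℚ :+ s)) :- s :* F :* (s :* F) :* r′
         := s :* F :* F :* con 1ℚ :* r′) refl s F r′ ⟩
  s * F * F * 1ℚ * r′
    ≡⟨ cong₂ (λ x m → x * F * 1ℚ * recip m) (ι-* (suc k) (k !)) (ℕ.+-comm k 1) ⟨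
  ι (suc k !) * F * 1ℚ * recip (k ℕ.+ 1) ∎
  where
  s = ι (suc k)
  F = ι (k !)
  r = recip k
  r′ = recip (suc k)
gram (suc j) k = begin
  t * t * φ j (shift (φ k moment)) 0 - φ j (shift (φ k moment)) 1
    ≡⟨ solve 4 (λ t s x y → t :* t :* x :- y
        := t :* t :* x :+ (s :* s :* x :- y) :- s :* s :* x) refl t s X (φ j (shift (φ k moment)) 1) ⟩
  t * t * X + (s * s * X - φ j (shift (φ k moment)) 1) - s * s * X
    ≡⟨ cong (λ y → t * t * X + y - s * s * X) X-suc ⟨
  t * t * X + φ j (shift (φ (suc k) moment)) 0 - s * s * X
    ≡⟨ cong₂ (λ x y → t * t * x + y - s * s * x) (gram j k) (gram j (suc k)) ⟩
  t * t * (A * a * (B′ * b) * r) + ι (suc (suc k) !) * A * (B′ * b) * q - s * s * (A * a * (B′ * b) * r)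
    ≡⟨ cong (λ x → t * t * (A * a * (B′ * b) * r) + x * A * (B′ * b) * q - s * s * (A * a * (B′ * b) * r)) A″ ⟩
  t * t * (A * a * (B′ * b) * r) + (1ℚ + s) * (s * a) * A * (B′ * b) * q - s * s * (A * a * (B′ * b) * r)
    ≡⟨ solve 8 (λ s t A a B b r q → t :* t :* (A :* a :* (B :* b) :* r) :+ (con 1ℚ :+ s) :* (s :* a) :* A :*
        (B :* b) :* q :- s :* s :* (A :* a :* (B :* b) :* r)
         := A :* a :* (B :* b) :* ((t :- s) :* (r :* (s :+ t)) :+ (con 1ℚ :+ s) :* s :* q))
             refl s t A a B′ b r q ⟩
  A * a * (B′ * b) * ((t - s) * (r * (s + t)) + (1ℚ + s) * s * q)
    ≡⟨ cong (λ x → A * a * (B′ * b) * ((t - s) * x + (1ℚ + s) * s * q)) (trans r-inverse (sym q-inverse)) ⟩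
  A * a * (B′ * b) * ((t - s) * (q * (1ℚ + s + t)) + (1ℚ + s) * s * q)
    ≡⟨ solve 7 (λ s t A a B b q → A :* a :* (B :* b) :* ((t :- s) :* (q :* (con 1ℚ :+ s :+ t)) :+
        (con 1ℚ :+ s) :* s :* q)
         := A :* a :* ((con 1ℚ :+ t) :* (t :* b) :* B) :* q) refl s t A a B′ b q ⟩
  A * a * ((1ℚ + t) * (t * b) * B′) * q
    ≡⟨ cong₂ (λ x m → A * a * (x * B′) * recip m) B″ (ℕ.+-suc k (suc j)) ⟨
  A * a * (ι (suc (suc j) !) * B′) * recip (k ℕ.+ suc (suc j)) ∎
  where
  X = φ j (shift (φ k moment)) 0
  s = ι (suc k)
  t = ι (suc j)
  A = ι (suc k !)
  a = ι (k !)
  B′ = ι (suc j !)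
  b = ι (j !)
  r = recip (k ℕ.+ suc j)
  q = recip (suc k ℕ.+ suc j)
  ι!! : ∀ n → ι (suc (suc n) !) ≡ (1ℚ + ι (suc n)) * (ι (suc n) * ι (n !))
  ι!! n = trans (ι! (suc n)) (cong ((1ℚ + ι (suc n)) *_) (ι-* (suc n) (n !)))
  A″ = ι!! k
  B″ = ι!! j
  r-inverse : r * (s + t) ≡ 1ℚ
  r-inverse = trans (cong (λ x → r * (x + t)) (ι-suc k)) (recip-inverse-+ k (suc j))
  q-inverse : q * (1ℚ + s + t) ≡ 1ℚ
  q-inverse = recip-inverse-+ (suc k) (suc j)
  X-suc : φ j (shift (φ (suc k) moment)) 0 ≡ s * s * X - φ j (shift (φ k moment)) 1
  X-suc = trans (linear-minus (φ-linear j 0) (s * s) (shift (φ k moment)) (shift (shift (φ k moment))))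
    (cong (λ y → s * s * X - y) (φ-shift j (shift (φ k moment)) 0))

-- The orthogonal polynomial Q

weight : ℕ → ℚ
weight k = suc k !⁻¹ * k !⁻¹

-- In terms of L(xⁱ) = a i: combination n a i = L(Q xⁱ), with Q of degree n independent of a.
-- The weights turn the Gram matrix of the φₖ into the Hilbert-type matrix 1 / (k + j + 2).

combination : ℕ → Series → Series
combination n a i = Φ n (λ k → weight k * φ k a i)

combination-shift : ∀ n a → combination n (shift a) ≗ shift (combination n a)
combination-shift n a i = Φ-linear n .≗-cong λ k → cong (weight k *_) (φ-shift k a i)

combination-moment : ∀ n → combination n moment 0 ≡ (- 1ℚ) ^ n * recip n * (harmonic n + harmonic (suc n))
combination-moment n = trans (Φ-linear n .≗-cong step) (Φ-double-pole n)
  where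
  step : ∀ k → weight k * φ k moment 0 ≡ recip k * recip k
  step k = begin
    weight k * φ k moment 0
      ≡⟨ cong (weight k *_) (φ-moment k) ⟩
    suc k !⁻¹ * k !⁻¹ * (ι (k !) * ι (k !) * recip k)
      ≡⟨ solve 4 (λ w u F r → w :* u :* (F :* F :* r)
          := r :* (F :* w) :* (F :* u)) refl (suc k !⁻¹) (k !⁻¹) (ι (k !)) (recip k) ⟩
    recip k * (ι (k !) * suc k !⁻¹) * (ι (k !) * k !⁻¹)
      ≡⟨ *-unitʳ _ (!*!⁻¹ k) ⟩
    recip k * (ι (k !) * suc k !⁻¹)
      ≡⟨ cong (recip k *_) (n!*[1+n]!⁻¹ k) ⟩
    recip k * recip k ∎

-- The weights cancel the factorials in k from `gram`, leaving Σ dₖ / (k + j + 2), the rational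
-- function at t = j + 2.
φ-combination : ∀ n j → φ j (shift (combination n moment)) 0 ≡ ι (suc j !) * ι (j !) * ρ n (suc j)
φ-combination n j = begin
  φ j (shift (combination n moment)) 0
    ≡⟨ linear-Φ (φ-linear j 0) n (λ k i → weight k * φ k moment (suc i)) ⟩
  Φ n (λ k → φ j (λ i → weight k * φ k moment (suc i)) 0)
    ≡⟨ Φ-linear n .≗-cong step ⟩
  Φ n (λ k → ι (suc j !) * ι (j !) * recip (k ℕ.+ suc j))
    ≡⟨ linear-scale (Φ-linear n) (ι (suc j !) * ι (j !)) (λ k → recip (k ℕ.+ suc j)) ⟩
  ι (suc j !) * ι (j !) * Φ n (λ k → recip (k ℕ.+ suc j))
    ≡⟨ cong (ι (suc j !) * ι (j !) *_) (Φ-pole n (suc j)) ⟩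
  ι (suc j !) * ι (j !) * ρ n (suc j) ∎
  where
  step : ∀ k → φ j (λ i → weight k * φ k moment (suc i)) 0 ≡ ι (suc j !) * ι (j !) * recip (k ℕ.+ suc j)
  step k = begin
    φ j (λ i → weight k * φ k moment (suc i)) 0
      ≡⟨ φ-scale j (weight k) (shift (φ k moment)) 0 ⟩
    weight k * φ j (shift (φ k moment)) 0
      ≡⟨ cong (weight k *_) (gram j k) ⟩
    suc k !⁻¹ * k !⁻¹ * (ι (suc k !) * ι (k !) * (ι (suc j !) * ι (j !)) * recip (k ℕ.+ suc j))
      ≡⟨ solve 6 (λ w u A a b r → w :* u :* (A :* a :* b :* r) := b :* r :* (A :* w) :* (a :* u)) refl
           (suc k !⁻¹) (k !⁻¹) (ι (suc k !)) (ι (k !)) (ι (suc j !) * ι (j !)) (recip (k ℕ.+ suc j)) ⟩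
    ι (suc j !) * ι (j !) * recip (k ℕ.+ suc j) * (ι (suc k !) * suc k !⁻¹) * (ι (k !) * k !⁻¹)
      ≡⟨ trans (*-unitʳ _ (!*!⁻¹ k)) (*-unitʳ _ (!*!⁻¹ (suc k))) ⟩
    ι (suc j !) * ι (j !) * recip (k ℕ.+ suc j) ∎

-- Passes from the basis φₖ to powers: x φₖ = (k + 1)² φₖ - φₖ₊₁ trades a power of x for a larger k.
φ-vanish : ∀ {n f} → (∀ k → k ℕ.< n → φ k f 0 ≡ 0ℚ) → ∀ j k → j ℕ.+ k ℕ.< n → φ k f j ≡ 0ℚ
φ-vanish z zero    k k<n = z k k<n
φ-vanish {n} {f} z (suc j) k j+k<n = begin
  φ k f (suc j)
    ≡⟨ solve 2 (λ x y → y := x :- (x :- y)) refl (s * s * φ k f j) (φ k f (suc j)) ⟩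
  s * s * φ k f j - φ (suc k) f j
    ≡⟨ cong₂ (λ x y → s * s * x - y) (φ-vanish z j k (ℕ.<-trans (ℕ.n<1+n _) j+k<n))
         (φ-vanish z j (suc k) (subst (ℕ._< n) (sym (ℕ.+-suc j k)) j+k<n)) ⟩
  s * s * 0ℚ - 0ℚ
    ≡⟨ solve 1 (λ s → s :* s :* con 0ℚ :- con 0ℚ := con 0ℚ) refl s ⟩
  0ℚ ∎
  where s = ι (suc k)

-- In total degree n only leading coefficients count: (-1)ᵏ for xʲ φₖ against (-1)ⁿ for φₙ, hence
-- the sign (-1)ʲ.
φ-diagonal : ∀ {n f} → (∀ k → k ℕ.< n → φ k f 0 ≡ 0ℚ) → ∀ j k → j ℕ.+ k ≡ n → φ k f j ≡ (- 1ℚ) ^ j * φ n f 0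
φ-diagonal {f = f} z zero k refl = sym (*-identityˡ (φ k f 0))
φ-diagonal {n} {f} z (suc j) k refl = begin
  φ k f (suc j)
    ≡⟨ solve 2 (λ x y → y := x :- (x :- y)) refl (s * s * φ k f j) (φ k f (suc j)) ⟩
  s * s * φ k f j - φ (suc k) f j
    ≡⟨ cong₂ (λ x y → s * s * x - y) (φ-vanish z j k ℕ.≤-refl) (φ-diagonal z j (suc k) (ℕ.+-suc j k)) ⟩
  s * s * 0ℚ - (- 1ℚ) ^ j * φ n f 0
    ≡⟨ solve 3 (λ s g x → s :* s :* con 0ℚ :- g :* x := :- con 1ℚ :* g :* x) refl s ((- 1ℚ) ^ j) (φ n f 0) ⟩
  (- 1ℚ) ^ suc j * φ n f 0 ∎
  where s = ι (suc k)

φ-combination-zero : ∀ n k → k ℕ.< n → φ k (shift (combination n moment)) 0 ≡ 0ℚ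
φ-combination-zero n k k<n = trans (φ-combination n k)
  (trans (cong (ι (suc k !) * ι (k !) *_) (ρ-root n k k<n)) (*-zeroʳ (ι (suc k !) * ι (k !))))

combination-vanish : ∀ n i → i ℕ.< n → combination n moment (suc i) ≡ 0ℚ
combination-vanish n i i<n = φ-vanish (φ-combination-zero n) i 0 (subst (ℕ._< n) (sym (ℕ.+-identityʳ i)) i<n)

combination-top : ∀ n → combination n moment (suc n) ≡ (- 1ℚ) ^ n * (ι (suc n !) * ι (n !) * ρ n (suc n))
combination-top n = trans (φ-diagonal (φ-combination-zero n) n 0 (ℕ.+-identityʳ n))
    (cong ((- 1ℚ) ^ n *_) (φ-combination n n))

-- The leading coefficient of that Q

leading : ℕ → ℚ
leading n = Φ n (λ k → weight k * φ k (δ n) 0)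

bordered-combination : ∀ n a → bordered n a (combination n a) ≡ hankel n a * leading n
bordered-combination n a = begin
  bordered n a (combination n a)
    ≡⟨ linear-Φ (bordered-linear n a) n (λ k i → weight k * φ k a i) ⟩
  Φ n (λ k → bordered n a (λ i → weight k * φ k a i))
    ≡⟨ Φ-cong n step ⟩
  Φ n (λ k → hankel n a * (weight k * φ k (δ n) 0))
    ≡⟨ linear-scale (Φ-linear n) (hankel n a) (λ k → weight k * φ k (δ n) 0) ⟩
  hankel n a * leading n ∎
  where
  step : ∀ k → k ℕ.≤ n → bordered n a (λ i → weight k * φ k a i) ≡ hankel n a * (weight k * φ k (δ n) 0)
  step k k≤n = begin
    bordered n a (λ i → weight k * φ k a i)   ≡⟨ linear-scale (bordered-linear n a) (weight k) (φ k a) ⟩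
    weight k * bordered n a (φ k a)           ≡⟨ cong (weight k *_) (bordered-φ n a k k≤n) ⟩
    weight k * (hankel n a * φ k (δ n) 0)     ≡⟨ solve 3 (λ w h d → w :* (h :* d)
        := h :* (w :* d)) refl (weight k) (hankel n a) (φ k (δ n) 0) ⟩
    hankel n a * (weight k * φ k (δ n) 0)     ∎

-- Comparing the two Hankel determinants

moment⁺ : Series
moment⁺ = shift moment

-- The new last column has entries L(Q xⁱ), which vanish below the top one.
hankel-moment : ∀ n → hankel n moment * leading n ≡ (- 1ℚ) ^ n * combination n moment 0 * hankelOfSize n moment⁺
hankel-moment n = trans (sym (bordered-combination n moment))
  (bordered-top n moment (combination n moment) (combination-vanish n))

-- The same Q serves the functional p ↦ L(x p): the entries are L(Q xⁱ⁺¹), which vanish above the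
-- bottom one.
hankel-moment⁺ : ∀ n → hankel n moment⁺ * leading n ≡ combination n moment (suc n) * hankelOfSize n moment⁺
hankel-moment⁺ n = begin
  hankel n moment⁺ * leading n
    ≡⟨ bordered-combination n moment⁺ ⟨
  bordered n moment⁺ (combination n moment⁺)
    ≡⟨ bordered-linear n moment⁺ .≗-cong (combination-shift n moment) ⟩
  bordered n moment⁺ (shift (combination n moment))
    ≡⟨ bordered-bottom n moment⁺ (shift (combination n moment)) (combination-vanish n) ⟩
  combination n moment (suc n) * hankelOfSize n moment⁺ ∎

Invertible : ℚ → Set
Invertible x = ∃ λ y → x * y ≡ 1ℚ

ρ-central : ∀ n → ρ n (suc n) * ι ((2 ℕ.* n ℕ.+ 2) !) ≡ ι (n !) * ι (suc n !)
ρ-central n = begin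
  ρ n (suc n) * ι ((2 ℕ.* n ℕ.+ 2) !)              ≡⟨ cong (λ k → ρ n (suc n) * ι (k !)) 2n+2 ⟩
  ρ n (suc n) * ι ((2 ℕ.+ n ℕ.+ n) !)              ≡⟨ cong (ρ n (suc n) *_) (*-identityˡ (ι
      ((2 ℕ.+ n ℕ.+ n) !))) ⟨
  ρ n (suc n) * (1ℚ * ι ((2 ℕ.+ n ℕ.+ n) !))       ≡⟨ ρ-factorial n 0 ⟩
  ι (n !) * ι (suc n !)                            ∎
  where
  2n+2 : 2 ℕ.* n ℕ.+ 2 ≡ 2 ℕ.+ n ℕ.+ n
  2n+2 = solveℕ 1 (λ n → conℕ 2 ⊗ n ⊕ conℕ 2 ⊜ conℕ 2 ⊕ n ⊕ n) refl n

combination-top-invertible : ∀ n → Invertible (combination n moment (suc n))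
-- By `ρ-central` the value is (-1)ⁿ ((n + 1)! n!)² / (2n + 2)!; the witness is its reciprocal.
combination-top-invertible n = g * (w * u * (w * u) * N) , (begin
  combination n moment (suc n) * (g * (w * u * (w * u) * N))
    ≡⟨ cong (_* (g * (w * u * (w * u) * N))) (combination-top n) ⟩
  g * (F′ * F * r) * (g * (w * u * (w * u) * N))
    ≡⟨ solve 7 (λ g F′ F r w u N → g :* (F′ :* F :* r) :* (g :* (w :* u :* (w :* u) :* N))
        := F′ :* F :* (w :* u :* (w :* u)) :* (r :* N) :* (g :* g))
         refl g F′ F r w u N ⟩
  F′ * F * (w * u * (w * u)) * (r * N) * (g * g)
    ≡⟨ cong₂ (λ x y → F′ * F * (w * u * (w * u)) * x * y) (ρ-central n) (sign² n) ⟩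
  F′ * F * (w * u * (w * u)) * (F * F′) * 1ℚ
    ≡⟨ solve 4 (λ F′ F w u → F′ :* F :* (w :* u :* (w :* u)) :* (F :* F′) :* con 1ℚ
        := F′ :* w :* (F :* u) :* (F′ :* w :* (F :* u)))
         refl F′ F w u ⟩
  F′ * w * (F * u) * (F′ * w * (F * u))
    ≡⟨ cong (λ x → x * x) (cong₂ _*_ (!*!⁻¹ (suc n)) (!*!⁻¹ n)) ⟩
  1ℚ ∎)
  where
  g = (- 1ℚ) ^ n
  F = ι (n !)
  F′ = ι (suc n !)
  u = n !⁻¹
  w = suc n !⁻¹
  r = ρ n (suc n)
  N = ι ((2 ℕ.* n ℕ.+ 2) !)

invertible-factors : ∀ x y z w → x * y ≡ z * w → Invertible z → Invertible w → Invertible x × Invertible y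
invertible-factors x y z w e (z′ , ez) (w′ , ew) =
  (y * (z′ * w′) , trans (solve 3 (λ x y v → x :* (y :* v) := x :* y :* v) refl x y (z′ * w′)) xyz′w′) ,
  (x * (z′ * w′) , trans (solve 3 (λ x y v → y :* (x :* v) := x :* y :* v) refl x y (z′ * w′)) xyz′w′)
  where
  xyz′w′ : x * y * (z′ * w′) ≡ 1ℚ
  xyz′w′ = begin
    x * y * (z′ * w′)      ≡⟨ cong (_* (z′ * w′)) e ⟩
    z * w * (z′ * w′)      ≡⟨ solve 4 (λ z w z′ w′ → z :* w :* (z′ :* w′)
        := z :* z′ :* (w :* w′)) refl z w z′ w′ ⟩
    z * z′ * (w * w′)      ≡⟨ cong₂ _*_ ez ew ⟩
    1ℚ                     ∎

-- In `hankel-moment⁺` the right side is a product of invertibles by induction, so the determinant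
-- of the next size and `leading n` are both invertible.
hankelOfSize-moment⁺-invertible : ∀ n → Invertible (hankelOfSize n moment⁺)
hankelOfSize-moment⁺-invertible zero    = 1ℚ , refl
hankelOfSize-moment⁺-invertible (suc n) = proj₁
  (invertible-factors (hankel n moment⁺) (leading n) (combination n moment (suc n)) (hankelOfSize n moment⁺)
    (hankel-moment⁺ n) (combination-top-invertible n) (hankelOfSize-moment⁺-invertible n))

leading-invertible : ∀ n → Invertible (leading n)
leading-invertible n = proj₂
  (invertible-factors (hankel n moment⁺) (leading n) (combination n moment (suc n)) (hankelOfSize n moment⁺)
    (hankel-moment⁺ n) (combination-top-invertible n) (hankelOfSize-moment⁺-invertible n))

*-cancelʳ-invertible : ∀ {x y z} → Invertible z → x * z ≡ y * z → x ≡ y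
*-cancelʳ-invertible {x} {y} {z} (z′ , e) xz≡yz = begin
  x              ≡⟨ *-unitʳ x e ⟨
  x * (z * z′)   ≡⟨ *-assoc x z z′ ⟨
  x * z * z′     ≡⟨ cong (_* z′) xz≡yz ⟩
  y * z * z′     ≡⟨ *-assoc y z z′ ⟩
  y * (z * z′)   ≡⟨ *-unitʳ y e ⟩
  y              ∎

factor : ℕ → ℚ
factor n = (+ ((2 ℕ.* n ℕ.+ 2) !) / (n ! ℕ.* (suc n !) ℕ.^ 3)) {{n!*[1+n]!³≢0 n}}

-- Origin of the constant in the theorem: L(Q xⁿ⁺¹) is (-1)ⁿ ((n + 1)! n!)² / (2n + 2)!, so the
-- product is (-1)ⁿ n! / (n + 1)!, the prefactor of the harmonic sum in L(Q).
factor-combination-top : ∀ n → factor n * combination n moment (suc n) ≡ (- 1ℚ) ^ n * recip n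
factor-combination-top n = begin
  K * combination n moment (suc n)
    ≡⟨ cong (K *_) (combination-top n) ⟩
  K * (g * (F′ * F * r))
    ≡⟨ trans (*-unitʳ _ (!*!⁻¹ (suc n))) (*-unitʳ _ (!*!⁻¹ (suc n))) ⟨
  K * (g * (F′ * F * r)) * (F′ * w) * (F′ * w)
    ≡⟨ solve 6 (λ K g F′ F r w → K :* (g :* (F′ :* F :* r)) :* (F′ :* w) :* (F′ :* w)
         := g :* w :* w :* (r :* (K :* (F :* (F′ :* (F′ :* (F′ :* con 1ℚ))))))) refl K g F′ F r w ⟩
  g * w * w * (r * (K * (F * (F′ * (F′ * (F′ * 1ℚ))))))
    ≡⟨ cong (λ x → g * w * w * (r * (K * x))) denominator ⟨
  g * w * w * (r * (K * ι (n ! ℕ.* (suc n !) ℕ.^ 3)))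
    ≡⟨ cong (λ x → g * w * w * (r * x)) (/-*-cancel ((2 ℕ.* n ℕ.+ 2) !) (n ! ℕ.*
        (suc n !) ℕ.^ 3) {{n!*[1+n]!³≢0 n}}) ⟩
  g * w * w * (r * ι ((2 ℕ.* n ℕ.+ 2) !))
    ≡⟨ cong (g * w * w *_) (ρ-central n) ⟩
  g * w * w * (F * F′)
    ≡⟨ solve 4 (λ g w F F′ → g :* w :* w :* (F :* F′) := g :* (F :* w) :* (F′ :* w)) refl g w F F′ ⟩
  g * (F * w) * (F′ * w)
    ≡⟨ *-unitʳ _ (!*!⁻¹ (suc n)) ⟩
  g * (F * w)
    ≡⟨ cong (g *_) (n!*[1+n]!⁻¹ n) ⟩
  g * recip n ∎
  where
  K = factor n
  g = (- 1ℚ) ^ n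
  F = ι (n !)
  F′ = ι (suc n !)
  w = suc n !⁻¹
  r = ρ n (suc n)
  denominator : ι (n ! ℕ.* (suc n !) ℕ.^ 3) ≡ F * (F′ * (F′ * (F′ * 1ℚ)))
  denominator = trans (ι-* (n !) ((suc n !) ℕ.^ 3)) (cong (F *_)
    (trans (ι-* (suc n !) ((suc n !) ℕ.^ 2)) (cong (F′ *_)
      (trans (ι-* (suc n !) ((suc n !) ℕ.^ 1)) (cong (F′ *_) (ι-* (suc n !) 1))))))

moment⁺-formula : ∀ k → moment⁺ k ≡ ι (2 ℕ.* k ℕ.+ 3) * B (2 ℕ.* k ℕ.+ 2)
moment⁺-formula k = cong₂ (λ i j → ι i * B j) (trans (cong (ℕ._+ 1) e) (ℕ.+-assoc (2 ℕ.* k) 2 1)) e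
  where
  e : 2 ℕ.* suc k ≡ 2 ℕ.* k ℕ.+ 2
  e = trans (ℕ.*-suc 2 k) (ℕ.+-comm 2 (2 ℕ.* k))

proposition6p2 : (n : ℕ) →
    hankel n (λ k → (+ (2 ℕ.* k ℕ.+ 1) / 1) * B (2 ℕ.* k))
    ≡ (- 1ℚ) ^ n * (+ ((2 ℕ.* n ℕ.+ 2) !) / (n ! ℕ.* (suc n !) ℕ.^ 3)) {{n!*[1+n]!³≢0 n}}
    * (harmonic n + harmonic (suc n))
    * hankel n (λ k → (+ (2 ℕ.* k ℕ.+ 3) / 1) * B (2 ℕ.* k ℕ.+ 2))
proposition6p2 n = begin
  hankel n moment
    ≡⟨ *-cancelʳ-invertible (leading-invertible n) scaled ⟩
  g * K * h * hankel n moment⁺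
    ≡⟨ cong (g * K * h *_) (det-cong {suc n} λ i j → moment⁺-formula (toℕ i ℕ.+ toℕ j)) ⟩
  g * K * h * hankel n (λ k → ι (2 ℕ.* k ℕ.+ 3) * B (2 ℕ.* k ℕ.+ 2)) ∎
  where
  g = (- 1ℚ) ^ n
  K = factor n
  h = harmonic n + harmonic (suc n)
  T = hankelOfSize n moment⁺
  scaled : hankel n moment * leading n ≡ g * K * h * hankel n moment⁺ * leading n
  scaled = begin
    hankel n moment * leading n
      ≡⟨ hankel-moment n ⟩
    g * combination n moment 0 * T
      ≡⟨ cong (λ x → g * x * T) (combination-moment n) ⟩
    g * (g * recip n * h) * T
      -- Trading the prefactor of L(Q) for a multiple of L(Q xⁿ⁺¹) makes the right side of
      -- `hankel-moment⁺` appear.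
      ≡⟨ cong (λ x → g * (x * h) * T) (factor-combination-top n) ⟨
    g * (K * combination n moment (suc n) * h) * T
      ≡⟨ solve 5 (λ g K v h T → g :* (K :* v :* h) :* T
          := g :* K :* h :* (v :* T)) refl g K (combination n moment (suc n)) h T ⟩
    g * K * h * (combination n moment (suc n) * T)
      ≡⟨ cong (g * K * h *_) (hankel-moment⁺ n) ⟨
    g * K * h * (hankel n moment⁺ * leading n)
      ≡⟨ *-assoc (g * K * h) (hankel n moment⁺) (leading n) ⟨
    g * K * h * hankel n moment⁺ * leading n ∎
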